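{- Let $n\ge 3$ and let $e$ be an edge of the complete graph $K_{n+1}$ on $\{0,1,\dots,n\}$ joining distinct vertices $i,j\in[n]$. Then the number of spherical parking functions of $K_{n+1}-\{e\}$ (with root $0$) is \[ |\mathrm{sPF}(K_{n+1}-\{e\})|=|\mathcal{U}_n'|=(n-1)^{n-3}(n-2)^2 . \]
   Context: $\mathbb{N}=\{0,1,2,\dots\}$, $[n]=\{1,\dots,n\}$. $K_{n+1}$ is the complete simple graph on $V=\{0,1,\dots,n\}$ with root $0$; $K_{n+1}-\{e\}$ is the graph on $V$ obtained by deleting the edge $e$. Spherical parking functions: let $R=\mathbb{K}[x_1,\dots,x_n]$ over a field $\mathbb{K}$. For an undirected loopless graph $G$ on $V$ with $a_{ij}$ edges between $i$ and $j$, and $\emptyset\ne A\subseteq[n]$, put $d_A(i)=\sum_{j\in V\setminus A}a_{ij}$ and $m_A=\prod_{i\in A}x_i^{d_A(i)}$. Let $\mathcal{M}_G=\langle m_A:\emptyset\neq A\subseteq[n]\rangle$ and $\mathcal{M}_G^{(k)}=\langle m_A:\emptyset\ne A\subseteq[n],\ |A|\le k+1\rangle$ for $0\le k\le n-1$. Then $\mathrm{sPF}(G)=\{(p_1,\dots,p_n)\in\mathbb{N}^n:\ \prod_i x_i^{p_i}\in\mathcal{M}_G\setminus\mathcal{M}_G^{(n-2)}\}$. Uprooted trees: a rooted labelled tree on vertex set $[n]$ is uprooted if its root is larger than all children of the root. $\mathcal{U}_n'$ is the set of uprooted trees on $[n]$ in which the vertices $1$ and $n$ are not adjacent. -}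

module Defs where

open import Level using (Level; 0ℓ; _⊔_)
open import Algebra.Apartness.Bundles using (HeytingField)
import Algebra.Properties.CommutativeMonoid.Sum as Sum
open import Data.Bool.Base using (Bool; true; false; T; if_then_else_)
open import Data.Bool.Properties using (∨-comm)
open import Data.Fin.Base as Fin using (Fin; zero; suc; toℕ)
import Data.Fin.Properties as Fin
open import Data.Fin.Subset using (Subset; Nonempty; ∣_∣; ∁; outside)
open import Data.List.Base using (List; []; _∷_; [_]; _++_; _∷ʳ_; foldr; cartesianProductWith)
open import Data.List.Relation.Unary.Linked using (Linked)
open import Data.List.Relation.Unary.Unique.Propositional using (Unique)
open import Data.Nat.Base as ℕ using (ℕ; zero; suc; _≤_; _∸_)
import Data.Nat.Properties as ℕ
open import Data.Product.Base using (Σ-syntax; ∃; _×_; _,_; proj₁)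
open import Data.Vec.Base using (Vec; lookup; tabulate; zipWith) renaming (_∷_ to _∷ᵛ_)
open import Data.Vec.Properties using (≡-dec)
open import Function.Bundles using (Inverse)
open import Relation.Binary.Bundles using (Setoid)
open import Relation.Binary.Construct.Closure.ReflexiveTransitive using (Star)
import Relation.Binary.Construct.On as On
open import Relation.Binary.PropositionalEquality as ≡ using (_≡_; refl; cong; cong₂)
open import Relation.Nullary using (¬_; does; yes; no; contradiction)
open import Relation.Nullary.Decidable using (_×-dec_; _⊎-dec_)
open import Relation.Unary using (Pred)

open Sum ℕ.+-0-commutativeMonoid using (sum)

private
  variable
    c ℓ₁ ℓ₂ s : Level

HasCardinality : ∀ {a ℓ} → Setoid a ℓ → ℕ → Set (a ⊔ ℓ)
HasCardinality S N = Inverse S (≡.setoid (Fin N))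

-- The subset of S cut out by P: elements are compared in S, ignoring the
-- proofs of P.
subsetoid : ∀ {a ℓ p} (S : Setoid a ℓ) → Pred (Setoid.Carrier S) p → Setoid (a ⊔ p) ℓ
subsetoid S P = On.setoid {B = ∃ P} S proj₁

------------------------------------------------------------------------
-- Undirected loopless graphs, with edge multiplicities

record Multigraph (m : ℕ) : Set where
  field
    edges    : Fin m → Fin m → ℕ
    symm     : ∀ u v → edges u v ≡ edges v u
    loopless : ∀ u → edges u u ≡ 0

complete : ∀ m → Multigraph m
complete m = record { edges = e ; symm = e-sym ; loopless = e-loop }
  where
  e : Fin m → Fin m → ℕ
  e u v = if does (u Fin.≟ v) then 0 else 1

  e-sym : ∀ u v → e u v ≡ e v u
  e-sym u v with u Fin.≟ v | v Fin.≟ u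
  ... | yes _ | yes _ = refl
  ... | no  _ | no  _ = refl
  ... | yes p | no  q = contradiction (≡.sym p) q
  ... | no  p | yes q = contradiction (≡.sym q) p

  e-loop : ∀ u → e u u ≡ 0
  e-loop u with u Fin.≟ u
  ... | yes _ = refl
  ... | no  p = contradiction refl p

-- Removes one edge between i and j (and does nothing if there is none).
deleteEdge : ∀ {m} → Multigraph m → Fin m → Fin m → Multigraph m
deleteEdge {m} G i j = record { edges = e ; symm = e-sym ; loopless = e-loop }
  where
  open Multigraph G

  joins : Fin m → Fin m → Bool
  joins u v = does ((u Fin.≟ i ×-dec v Fin.≟ j) ⊎-dec (v Fin.≟ i ×-dec u Fin.≟ j))

  e : Fin m → Fin m → ℕ
  e u v = if joins u v then edges u v ∸ 1 else edges u v

  e-sym : ∀ u v → e u v ≡ e v u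
  e-sym u v = cong₂ (λ b k → if b then k ∸ 1 else k)
    (∨-comm (does (u Fin.≟ i ×-dec v Fin.≟ j)) (does (v Fin.≟ i ×-dec u Fin.≟ j)))
    (symm u v)

  e-loop : ∀ u → e u u ≡ 0
  e-loop u with joins u u
  ... | true  = cong (_∸ 1) (loopless u)
  ... | false = loopless u

------------------------------------------------------------------------
-- The polynomial ring 𝕂[x₁,…,xₙ] and its ideals

-- On Heyting fields: classically, tightness makes _#_ the negation of
-- _≈_, so that these are exactly the fields (0 ≠ 1 being automatic).
module Polynomial (𝕂 : HeytingField c ℓ₁ ℓ₂) (n : ℕ) where
  private module 𝕂 = HeytingField 𝕂

  Exponent : Set
  Exponent = Vec ℕ n

  -- A polynomial is a formal sum of terms a·xᵘ; exponents may repeat and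
  -- coefficients may vanish, so equality is equality of all coefficients.
  Poly : Set c
  Poly = List (𝕂.Carrier × Exponent)

  coeff : Poly → Exponent → 𝕂.Carrier
  coeff []            v = 𝕂.0#
  coeff ((a , u) ∷ f) v = if does (≡-dec ℕ._≟_ u v) then a 𝕂.+ coeff f v else coeff f v

  infix 4 _≈ₚ_
  _≈ₚ_ : Poly → Poly → Set ℓ₁
  f ≈ₚ g = ∀ v → coeff f v 𝕂.≈ coeff g v

  0ₚ : Poly
  0ₚ = []

  infixl 6 _+ₚ_
  _+ₚ_ : Poly → Poly → Poly
  _+ₚ_ = _++_

  infixl 7 _*ₚ_
  _*ₚ_ : Poly → Poly → Poly
  _*ₚ_ = cartesianProductWith (λ (a , u) (b , v) → (a 𝕂.* b , zipWith ℕ._+_ u v))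

  x^_ : Exponent → Poly
  x^ v = [ (𝕂.1# , v) ]

  -- f ∈⟨ S ⟩ : f = q₁g₁ + … + qᵣgᵣ for some polynomials qᵢ and some gᵢ ∈ S.
  infix 4 _∈⟨_⟩
  _∈⟨_⟩ : Poly → Pred Poly s → Set (c ⊔ ℓ₁ ⊔ s)
  f ∈⟨ S ⟩ = Σ[ ts ∈ List (Poly × ∃ S) ]
    f ≈ₚ foldr (λ (q , g , _) r → q *ₚ g +ₚ r) 0ₚ ts

------------------------------------------------------------------------
-- Spherical parking functions

-- The graph has vertex set V = {0,…,n} = Fin (suc n) with root zero; the
-- element i of [n] = {1,…,n} is i : Fin n seen from [n] and suc i from V.
-- Accordingly A ⊆ [n] becomes outside ∷ᵛ A as a subset of V.
module _ {n : ℕ} (G : Multigraph (suc n)) where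
  open Multigraph G

  d : Subset n → Fin n → ℕ
  d A i = sum (λ v → if lookup (∁ (outside ∷ᵛ A)) v then edges (suc i) v else 0)

  -- The exponent of m_A = ∏_{i ∈ A} xᵢ^(d A i).
  mExponent : Subset n → Vec ℕ n
  mExponent A = tabulate (λ i → if lookup A i then d A i else 0)

  module _ (𝕂 : HeytingField c ℓ₁ ℓ₂) where
    open Polynomial 𝕂 n

    ℳ-generator : Pred Poly c
    ℳ-generator g = Σ[ A ∈ Subset n ] Nonempty A × g ≡ x^ mExponent A

    ℳ⁽_⁾-generator : ℕ → Pred Poly c
    ℳ⁽ k ⁾-generator g =
      Σ[ A ∈ Subset n ] Nonempty A × ∣ A ∣ ≤ k ℕ.+ 1 × g ≡ x^ mExponent A

    IsSphericalPF : Pred (Vec ℕ n) (c ⊔ ℓ₁)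
    IsSphericalPF p =
      (x^ p) ∈⟨ ℳ-generator ⟩ × ¬ ((x^ p) ∈⟨ ℳ⁽ n ∸ 2 ⁾-generator ⟩)

sPF : HeytingField c ℓ₁ ℓ₂ → ∀ {n} → Multigraph (suc n) → Setoid (c ⊔ ℓ₁) 0ℓ
sPF 𝕂 {n} G = subsetoid (≡.setoid (Vec ℕ n)) (IsSphericalPF G 𝕂)

------------------------------------------------------------------------
-- Uprooted trees

record SimpleGraph (n : ℕ) : Set where
  field
    adj    : Fin n → Fin n → Bool
    symm   : ∀ u v → adj u v ≡ adj v u
    irrefl : ∀ u → adj u u ≡ false

  Adjacent : Fin n → Fin n → Set
  Adjacent u v = T (adj u v)

  Connected : Set
  Connected = ∀ u v → Star Adjacent u v

  -- A cycle is a closed walk u — v — w — … — u through at least three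
  -- vertices, with no repetition other than its endpoint.
  Acyclic : Set
  Acyclic = ∀ u v w vs → let cycle = u ∷ v ∷ w ∷ vs in
    Unique cycle → ¬ Linked Adjacent (cycle ∷ʳ u)

record RootedTree (n : ℕ) : Set where
  field
    graph : SimpleGraph n
    root  : Fin n
  open SimpleGraph graph public
  field
    connected : Connected
    acyclic   : Acyclic

-- Labelled trees are equal when they have the same root and the same edges
-- (no isomorphism is involved).
rootedTrees : ℕ → Setoid 0ℓ 0ℓ
rootedTrees n = record
  { Carrier       = RootedTree n
  ; _≈_           = λ S T → root S ≡ root T × (∀ u v → adj S u v ≡ adj T u v)
  ; isEquivalence = record
    { refl  = refl , λ _ _ → refl
    ; sym   = λ (p , q) → ≡.sym p , λ u v → ≡.sym (q u v)
    ; trans = λ (p , q) (p′ , q′) → ≡.trans p p′ , λ u v → ≡.trans (q u v) (q′ u v)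
    }
  }
  where open RootedTree

-- The element of [n] = {1,…,n} represented by u : Fin n.
label : ∀ {n} → Fin n → ℕ
label u = suc (toℕ u)

-- The children of the root are its neighbours.
Uprooted : ∀ {n} → RootedTree n → Set
Uprooted T = ∀ v → Adjacent root v → label v ℕ.< label root
  where open RootedTree T

1≁n : ∀ {n} → RootedTree n → Set
1≁n {n} T = ∀ u v → label u ≡ 1 → label v ≡ n → ¬ Adjacent u v
  where open RootedTree T

𝒰′ : ℕ → Setoid 0ℓ 0ℓ
𝒰′ n = subsetoid (rootedTrees n) (λ T → Uprooted T × 1≁n T)

module Submission where

-- Both families are counted by exploring H = Kₙ − {i j} from an initial vertex.
-- At each moment a vertex is done, active or fresh; processing an active
-- vertex p makes it done and activates a set S of fresh neighbours of p. For a
-- rooted tree, S consists of the children of p. For a spherical parking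
-- function w, a fresh v lies in S when w v is one more than the number of its
-- neighbours already done (Dhar's burning algorithm). In both cases the
-- sequence of sets S is arbitrary and determines the object, so that the number
-- of objects depends only on the numbers of active and fresh vertices and on
-- the positions of i and j. Parking functions are sorted by their set Z of ones,
-- starting from a vertex of Z other than i and j (which is adjacent to every
-- vertex of H); uprooted trees are sorted by the set Z formed by the root and
-- its children, with root max Z and with {i, j} = {1, n}. For every Y disjoint
-- from {i, j}, the sets Z with Z − {i, j} = Y contribute equally to both
-- counts, and the sum over Y is a binomial identity.
open import Defs
open import Level using (Level; Lift)
open import Algebra.Apartness.Bundles using (HeytingField)
open import Algebra.Bundles using (CommutativeRing)
import Algebra.Properties.CommutativeMonoid.Sum as Sum
import Algebra.Properties.Group as Group
open import Data.Bool.Base using (Bool; true; false; not; if_then_else_; _∨_; _∧_; T)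
import Data.Bool.Properties as Bool
open import Data.Empty using (⊥-elim)
open import Data.Fin.Base as Fin using (Fin; zero; suc; toℕ; fromℕ)
import Data.Fin.Properties as Fin
open import Data.Fin.Subset using (Subset; ∣_∣; ∁; ⊤; inside; outside; _─_; _∪_)
open import Data.Fin.Subset.Properties using (∣⊤∣≡n)
open import Data.List.Base using (List; []; _∷_; _∷ʳ_; foldr)
open import Data.List.Membership.Propositional using (_∈_)
open import Data.List.Relation.Unary.All as All using (All; []; _∷_)
open import Data.List.Relation.Unary.All.Properties using (¬Any⇒All¬)
open import Data.List.Relation.Unary.Any as Any using (here; there)
open import Data.List.Relation.Unary.AllPairs using ([]; _∷_)
open import Data.List.Relation.Unary.Linked as Linked using (Linked; []; [-]; _∷_)
open import Data.List.Relation.Unary.Unique.Propositional using (Unique)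
open import Data.Nat.Base using (ℕ; zero; suc; _+_; _*_; _^_; _≤_; _<_; _∸_; z≤n; s≤s; ≢-nonZero)
import Data.Nat.Properties as ℕ
open import Data.Nat.Tactic.RingSolver using (solve-∀)
open import Data.Product.Base using (Σ; ∃; _×_; _,_; proj₁; proj₂)
open import Data.Sum.Base as Sum′ using (_⊎_; inj₁; inj₂; [_,_]′)
import Data.Unit.Base as Unit
open import Data.Vec.Base using (Vec; []; _∷_; lookup; tabulate; zipWith; _[_]≔_)
open import Data.Vec.Properties using (lookup-zipWith; lookup∘tabulate; tabulate∘lookup; tabulate-cong;
  lookup∘updateAt; lookup∘updateAt′; lookup-map; lookup-replicate; ∷-injectiveˡ; ∷-injectiveʳ;
  []=⇒lookup; lookup⇒[]=; ≡-dec)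
open import Function.Base using (_∘_; id; const)
open import Function.Bundles using (Inverse; mk⇔)
import Function.Construct.Composition as Compose
open import Relation.Binary.Bundles using (Setoid)
open import Relation.Binary.Construct.Closure.ReflexiveTransitive as Star using (Star; ε; _◅_; _◅◅_)
open import Relation.Binary.Definitions using (DecidableEquality)
open import Relation.Binary.PropositionalEquality
open import Relation.Nullary using (¬_; Dec; does; yes; no; contradiction)
open import Relation.Nullary.Decidable using (dec-true; dec-false; _×-dec_; _⊎-dec_; ¬?; does-⇔; T?)
open import Relation.Unary using (Pred; Decidable)

open Sum ℕ.+-0-commutativeMonoid using (sum)

-- Cardinalities

-- Neither family is mapped to the other. What they share is a recurrence: `System` lists the facts
-- from which the number of objects follows by recursion along the exploration, whatever the
-- recorded values mean. The missing edge matters only until one of i, j is done or both are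
-- discovered; hence three counts: D while both are fresh, X when one is active and the other fresh,
-- C afterwards. They suffice because the active vertex to be processed may be chosen at will, and X
-- processes the active end of the pair at once. Let Y have s + 1 elements and let t vertices lie
-- outside Y and {i, j}. Over Y, parking functions contribute D s t, X s t, X s t and C (2 + s) t,
-- for Z containing neither, one or both of i and j. Trees contribute nothing if Z contains both,
-- since n would be the root and 1 its child. But if Z contains n and not 1, the root n is done
-- after the first step, which leaves C (1 + s) (1 + t) = X s t + C (2 + s) t, and this makes up for
-- the loss. If Y is empty, both families contribute 0.

Card : ∀ {a p} {A : Set a} → Pred A p → ℕ → Set _
Card {A = A} P = HasCardinality (subsetoid (setoid A) P)

module _ {a p q} {A : Set a} {P : Pred A p} {Q : Pred A q} where

  card-⇔ : (∀ {x} → P x → Q x) → (∀ {x} → Q x → P x) → ∀ {N} → Card P N → Card Q N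
  card-⇔ f g c = record
    { to        = λ (x , qx) → to (x , g qx)
    ; from      = λ y → let (x , px) = from y in x , f px
    ; to-cong   = to-cong
    ; from-cong = from-cong
    ; inverse   = inverseˡ , inverseʳ
    }
    where open Inverse c

  -- Disjointness makes `to` well defined: elements are compared without their proofs, so one x must
  -- not be sent to both summands.
  card-⊎ : (∀ {x} → P x → ¬ Q x) → ∀ {M N} → Card P M → Card Q N → Card (λ x → P x ⊎ Q x) (M + N)
  card-⊎ disjoint {M} {N} c d = record
    { to        = to
    ; from      = from
    ; to-cong   = λ {x} {y} → to-cong x y
    ; from-cong = λ { refl → refl }
    ; inverse   = (λ {y} {x} eq → trans (to-cong x (from y) eq) (to-from y)) , λ { {x} refl → from-to x }
    }
    where
    module C = Inverse c
    module D = Inverse d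

    to : Σ A (λ x → P x ⊎ Q x) → Fin (M + N)
    to (x , inj₁ px) = Fin.join M N (inj₁ (C.to (x , px)))
    to (x , inj₂ qx) = Fin.join M N (inj₂ (D.to (x , qx)))

    from′ : Fin M ⊎ Fin N → Σ A (λ x → P x ⊎ Q x)
    from′ (inj₁ y) = proj₁ (C.from y) , inj₁ (proj₂ (C.from y))
    from′ (inj₂ y) = proj₁ (D.from y) , inj₂ (proj₂ (D.from y))

    from : Fin (M + N) → Σ A (λ x → P x ⊎ Q x)
    from y = from′ (Fin.splitAt M y)

    to-cong : ∀ x y → proj₁ x ≡ proj₁ y → to x ≡ to y
    to-cong (_ , inj₁ p) (_ , inj₁ q) eq   = cong (Fin.join M N ∘ inj₁) (C.to-cong eq)
    to-cong (_ , inj₂ p) (_ , inj₂ q) eq   = cong (Fin.join M N ∘ inj₂) (D.to-cong eq)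
    to-cong (_ , inj₁ p) (_ , inj₂ q) refl = contradiction q (disjoint p)
    to-cong (_ , inj₂ p) (_ , inj₁ q) refl = contradiction p (disjoint q)

    to-from′ : ∀ y → to (from′ y) ≡ Fin.join M N y
    to-from′ (inj₁ y) = cong (Fin.join M N ∘ inj₁) (C.inverseˡ refl)
    to-from′ (inj₂ y) = cong (Fin.join M N ∘ inj₂) (D.inverseˡ refl)

    to-from : ∀ y → to (from y) ≡ y
    to-from y = trans (to-from′ (Fin.splitAt M y)) (Fin.join-splitAt M N y)

    from-to : ∀ x → proj₁ (from (to x)) ≡ proj₁ x
    from-to (x , inj₁ px) = trans (cong (proj₁ ∘ from′) (Fin.splitAt-join M N (inj₁ _))) (C.inverseʳ refl)
    from-to (x , inj₂ qx) = trans (cong (proj₁ ∘ from′) (Fin.splitAt-join M N (inj₂ _))) (D.inverseʳ refl)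

module _ {a p} {A : Set a} {P : Pred A p} where

  card-∅ : (∀ {x} → ¬ P x) → Card P 0
  card-∅ ¬P = record
    { to        = λ (_ , px) → ⊥-elim (¬P px)
    ; from      = λ ()
    ; to-cong   = λ { {_ , px} → ⊥-elim (¬P px) }
    ; from-cong = λ { {()} }
    ; inverse   = (λ { {()} }) , λ { {_ , px} → ⊥-elim (¬P px) }
    }

  card-singleton : ∀ {x} → P x → (∀ {y} → P y → y ≡ x) → Card P 1
  card-singleton {x} px unique = record
    { to        = λ _ → zero
    ; from      = λ _ → x , px
    ; to-cong   = λ _ → refl
    ; from-cong = λ _ → refl
    ; inverse   = (λ { {zero} _ → refl }) , λ { {_ , py} _ → sym (unique py) }
    }

card-via : ∀ {a ℓ b p} {S : Setoid a ℓ} {A : Set b} {P : Pred A p} {N} →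
           Inverse S (subsetoid (setoid A) P) → Card P N → HasCardinality S N
card-via f c = Compose.inverse f c

-- Subsets and sums over subsets

infix 4 _⊑_
_⊑_ : ∀ {n} → Subset n → Subset n → Set
S ⊑ Q = ∀ v → lookup S v ≡ true → lookup Q v ≡ true

Σ⊆ : ∀ {n} → Subset n → (Subset n → ℕ) → ℕ
Σ⊆ []            g = g []
Σ⊆ (outside ∷ Q) g = Σ⊆ Q (g ∘ (outside ∷_))
Σ⊆ (inside ∷ Q)  g = Σ⊆ Q (g ∘ (inside ∷_)) + Σ⊆ Q (g ∘ (outside ∷_))

∷-⊑ : ∀ {n} {x y} {S Q : Subset n} → (x ≡ true → y ≡ true) → S ⊑ Q → (x ∷ S) ⊑ (y ∷ Q)
∷-⊑ h S⊑Q zero    = h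
∷-⊑ h S⊑Q (suc v) = S⊑Q v

Σ⊆-cong : ∀ {n} (Q : Subset n) {g h} → (∀ S → S ⊑ Q → g S ≡ h S) → Σ⊆ Q g ≡ Σ⊆ Q h
Σ⊆-cong []            eq = eq [] λ ()
Σ⊆-cong (outside ∷ Q) eq = Σ⊆-cong Q λ S S⊑Q → eq _ (∷-⊑ id S⊑Q)
Σ⊆-cong (inside ∷ Q)  eq = cong₂ _+_
  (Σ⊆-cong Q λ S S⊑Q → eq _ (∷-⊑ id S⊑Q))
  (Σ⊆-cong Q λ S S⊑Q → eq _ (∷-⊑ (λ _ → refl) S⊑Q))

-- Since x determines S, it is counted in one fibre only. The recursion splits on whether the first
-- element of Q belongs to S.
card-Σ⊆ : ∀ {a p} {A : Set a} {n} (Q : Subset n) {K : Subset n → Pred A p} {g : Subset n → ℕ} →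
          (∀ {S T x} → K S x → K T x → S ≡ T) →
          (∀ S → S ⊑ Q → Card (K S) (g S)) →
          Card (λ x → ∃ λ S → S ⊑ Q × K S x) (Σ⊆ Q g)
card-Σ⊆ []            disjoint c =
  card-⇔ (λ k → [] , (λ ()) , k) (λ { ([] , _ , k) → k }) (c [] λ ())
card-Σ⊆ (outside ∷ Q) disjoint c = card-⇔
  (λ (S , S⊑Q , k) → outside ∷ S , ∷-⊑ id S⊑Q , k)
  (λ { (outside ∷ S , S⊑Q , k) → S , (λ v → S⊑Q (suc v)) , k
     ; (inside ∷ S , S⊑Q , k) → contradiction (S⊑Q zero refl) λ () })
  (card-Σ⊆ Q (λ k l → ∷-injectiveʳ (disjoint k l)) (λ S S⊑Q → c _ (∷-⊑ id S⊑Q)))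
card-Σ⊆ (inside ∷ Q)  disjoint c = card-⇔
  (λ { (inj₁ (S , S⊑Q , k)) → inside ∷ S , ∷-⊑ id S⊑Q , k
     ; (inj₂ (S , S⊑Q , k)) → outside ∷ S , ∷-⊑ (λ _ → refl) S⊑Q , k })
  (λ { (inside ∷ S , S⊑Q , k) → inj₁ (S , (λ v → S⊑Q (suc v)) , k)
     ; (outside ∷ S , S⊑Q , k) → inj₂ (S , (λ v → S⊑Q (suc v)) , k) })
  (card-⊎ (λ (_ , _ , k) (_ , _ , l) → contradiction (∷-injectiveˡ (disjoint k l)) λ ())
    (card-Σ⊆ Q (λ k l → ∷-injectiveʳ (disjoint k l)) (λ S S⊑Q → c _ (∷-⊑ id S⊑Q)))
    (card-Σ⊆ Q (λ k l → ∷-injectiveʳ (disjoint k l)) (λ S S⊑Q → c _ (∷-⊑ (λ _ → refl) S⊑Q))))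

vec-ext : ∀ {a} {A : Set a} {n} {u v : Vec A n} → (∀ i → lookup u i ≡ lookup v i) → u ≡ v
vec-ext {u = u} {v} eq = trans (sym (tabulate∘lookup u)) (trans (tabulate-cong eq) (tabulate∘lookup v))

⊑-antisym : ∀ {n} {S T : Subset n} → S ⊑ T → T ⊑ S → S ≡ T
⊑-antisym {S = S} {T} S⊑T T⊑S = vec-ext λ v → eq v (lookup S v) (lookup T v) refl refl
  where
  eq : ∀ v x y → lookup S v ≡ x → lookup T v ≡ y → lookup S v ≡ lookup T v
  eq v true  _     hS _  = trans hS (sym (S⊑T v hS))
  eq v false true  _  hT = trans (T⊑S v hT) (sym hT)
  eq v false false hS hT = trans hS (sym hT)

lookup-∁ : ∀ {n} (A : Subset n) v → lookup (∁ A) v ≡ not (lookup A v)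
lookup-∁ A v = lookup-map v not A

lookup-─ : ∀ {n} (A B : Subset n) v → lookup (A ─ B) v ≡ (if lookup B v then false else lookup A v)
lookup-─ (x ∷ A) (false ∷ B) zero    = refl
lookup-─ (x ∷ A) (true ∷ B)  zero    = refl
lookup-─ (x ∷ A) (y ∷ B)     (suc v) = lookup-─ A B v

delete : ∀ {n} → Subset n → Fin n → Subset n
delete A v = A [ v ]≔ false

lookup-delete : ∀ {n} (A : Subset n) v → lookup (delete A v) v ≡ false
lookup-delete A v = lookup∘updateAt v A

lookup-delete′ : ∀ {n} (A : Subset n) {u v} → u ≢ v → lookup (delete A v) u ≡ lookup A u
lookup-delete′ A {u} {v} u≢v = lookup∘updateAt′ u v u≢v A

lookup-delete⁻ : ∀ {n} (A : Subset n) u v → lookup (delete A v) u ≡ true → u ≢ v × lookup A u ≡ true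
lookup-delete⁻ A u v h = u≢v , trans (sym (lookup-delete′ A u≢v)) h
  where
  u≢v : u ≢ v
  u≢v refl = contradiction (trans (sym h) (lookup-delete A u)) λ ()

∣delete∣ : ∀ {n} (A : Subset n) v → lookup A v ≡ true → ∣ A ∣ ≡ suc ∣ delete A v ∣
∣delete∣ (true ∷ A)  zero    h = refl
∣delete∣ (true ∷ A)  (suc v) h = cong suc (∣delete∣ A v h)
∣delete∣ (false ∷ A) (suc v) h = ∣delete∣ A v h

∣∣≡0⇒empty : ∀ {n} (A : Subset n) → ∣ A ∣ ≡ 0 → ∀ v → lookup A v ≡ false
∣∣≡0⇒empty (false ∷ A) h zero    = refl
∣∣≡0⇒empty (false ∷ A) h (suc v) = ∣∣≡0⇒empty A h v

∣∣≡suc⇒nonempty : ∀ {n} (A : Subset n) {m} → ∣ A ∣ ≡ suc m → ∃ λ v → lookup A v ≡ true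
∣∣≡suc⇒nonempty (true ∷ A)  h = zero , refl
∣∣≡suc⇒nonempty (false ∷ A) h = let (v , hv) = ∣∣≡suc⇒nonempty A h in suc v , hv

∣disjoint∪∣ : ∀ {n} (A B : Subset n) → (∀ v → lookup B v ≡ true → lookup A v ≡ false) →
              ∣ A ∪ B ∣ ≡ ∣ A ∣ + ∣ B ∣
∣disjoint∪∣ []          []          h = refl
∣disjoint∪∣ (true ∷ A)  (true ∷ B)  h = contradiction (h zero refl) λ ()
∣disjoint∪∣ (true ∷ A)  (false ∷ B) h = cong suc (∣disjoint∪∣ A B (h ∘ suc))
∣disjoint∪∣ (false ∷ A) (true ∷ B)  h = trans (cong suc (∣disjoint∪∣ A B (h ∘ suc))) (sym (ℕ.+-suc _ _))
∣disjoint∪∣ (false ∷ A) (false ∷ B) h = ∣disjoint∪∣ A B (h ∘ suc)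

∣─∣ : ∀ {n} (A B : Subset n) → B ⊑ A → ∣ B ∣ + ∣ A ─ B ∣ ≡ ∣ A ∣
∣─∣ []          []          h = refl
∣─∣ (true ∷ A)  (true ∷ B)  h = cong suc (∣─∣ A B (h ∘ suc))
∣─∣ (true ∷ A)  (false ∷ B) h = trans (ℕ.+-suc _ _) (cong suc (∣─∣ A B (h ∘ suc)))
∣─∣ (false ∷ A) (true ∷ B)  h = contradiction (h zero refl) λ ()
∣─∣ (false ∷ A) (false ∷ B) h = ∣─∣ A B (h ∘ suc)

∣∁∣ : ∀ {n} (A : Subset n) → ∣ A ∣ + ∣ ∁ A ∣ ≡ n
∣∁∣ []          = refl
∣∁∣ (true ∷ A)  = cong suc (∣∁∣ A)
∣∁∣ (false ∷ A) = trans (ℕ.+-suc _ _) (cong suc (∣∁∣ A))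

-- Binomial sums

-- bin u φ = Σₛ (u choose s) φ(s, u − s)
bin : ℕ → (ℕ → ℕ → ℕ) → ℕ
bin zero    φ = φ 0 0
bin (suc u) φ = bin u (λ s t → φ (suc s) t) + bin u (λ s t → φ s (suc t))

bin-cong : ∀ u {φ ψ} → (∀ s t → s + t ≡ u → φ s t ≡ ψ s t) → bin u φ ≡ bin u ψ
bin-cong zero    eq = eq 0 0 refl
bin-cong (suc u) eq = cong₂ _+_
  (bin-cong u λ s t e → eq (suc s) t (cong suc e))
  (bin-cong u λ s t e → eq s (suc t) (trans (ℕ.+-suc s t) (cong suc e)))

interchange : ∀ a b c d → (a + b) + (c + d) ≡ (a + c) + (b + d)
interchange = solve-∀

bin-+ : ∀ u φ ψ → bin u (λ s t → φ s t + ψ s t) ≡ bin u φ + bin u ψ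
bin-+ zero    φ ψ = refl
bin-+ (suc u) φ ψ = trans (cong₂ _+_ (bin-+ u _ _) (bin-+ u _ _)) (interchange (bin u _) _ _ _)

bin-* : ∀ u a φ → bin u (λ s t → a * φ s t) ≡ a * bin u φ
bin-* zero    a φ = refl
bin-* (suc u) a φ = trans (cong₂ _+_ (bin-* u a _) (bin-* u a _)) (sym (ℕ.*-distribˡ-+ a _ _))

-- u b^(u − 1)
der : ℕ → ℕ → ℕ
der b zero    = 0
der b (suc u) = suc u * b ^ u

*-der : ∀ b u → b * der b u ≡ u * b ^ u
*-der b zero    = ℕ.*-zeroʳ b
*-der b (suc u) = lemma b u (b ^ u)
  where
  lemma : ∀ b u x → b * (suc u * x) ≡ suc u * (b * x)
  lemma = solve-∀

der-suc : ∀ b u → der b (suc u) ≡ b ^ u + b * der b u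
der-suc b u = cong (b ^ u +_) (sym (*-der b u))

-- The binomial theorem for (1 + b)^u.
bin-^ : ∀ u b → bin u (λ s t → b ^ t) ≡ suc b ^ u
bin-^ zero    b = refl
bin-^ (suc u) b = cong₂ _+_ (bin-^ u b) (trans (bin-* u b _) (cong (b *_) (bin-^ u b)))

-- The binomial theorem differentiated with respect to b.
bin-der : ∀ u b → bin u (λ s t → der b t) ≡ der (suc b) u
bin-der zero    b = refl
bin-der (suc u) b = begin
  bin u (λ s t → der b t) + bin u (λ s t → der b (suc t))
    ≡⟨ cong (bin u (λ s t → der b t) +_) (bin-cong u λ s t _ → der-suc b t) ⟩
  bin u (λ s t → der b t) + bin u (λ s t → b ^ t + b * der b t)
    ≡⟨ cong (bin u (λ s t → der b t) +_) (trans (bin-+ u _ _) (cong₂ _+_ (bin-^ u b) (bin-* u b _))) ⟩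
  bin u (λ s t → der b t) + (suc b ^ u + b * bin u (λ s t → der b t))
    ≡⟨ cong (λ x → x + (suc b ^ u + b * x)) (bin-der u b) ⟩
  der (suc b) u + (suc b ^ u + b * der (suc b) u)
    ≡⟨ lemma (der (suc b) u) (suc b ^ u) b ⟩
  suc b ^ u + suc b * der (suc b) u
    ≡⟨ der-suc (suc b) u ⟨
  der (suc b) (suc u) ∎
  where
  open ≡-Reasoning
  lemma : ∀ x y b → x + (y + b * x) ≡ y + suc b * x
  lemma = solve-∀

-- The expansion of (a + b)^u differentiated with respect to a, at a = 1.
bin-s : ∀ u b → bin u (λ s t → s * b ^ t) ≡ der (suc b) u
bin-s zero    b = refl
bin-s (suc u) b = begin
  bin u (λ s t → b ^ t + s * b ^ t) + bin u (λ s t → s * (b * b ^ t))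
    ≡⟨ cong₂ _+_ (trans (bin-+ u _ _) (cong (_+ bin u (λ s t → s * b ^ t)) (bin-^ u b)))
                 (trans (bin-cong u λ s t _ → swap s b (b ^ t)) (bin-* u b _)) ⟩
  suc b ^ u + bin u (λ s t → s * b ^ t) + b * bin u (λ s t → s * b ^ t)
    ≡⟨ cong (λ x → suc b ^ u + x + b * x) (bin-s u b) ⟩
  suc b ^ u + der (suc b) u + b * der (suc b) u
    ≡⟨ ℕ.+-assoc (suc b ^ u) _ _ ⟩
  suc b ^ u + suc b * der (suc b) u
    ≡⟨ der-suc (suc b) u ⟨
  der (suc b) (suc u) ∎
  where
  open ≡-Reasoning
  swap : ∀ s b x → s * (b * x) ≡ b * (s * x)
  swap = solve-∀

bin-affine : ∀ u k b → bin u (λ s t → (k + s) * b ^ t) ≡ k * suc b ^ u + der (suc b) u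
bin-affine u k b = begin
  bin u (λ s t → (k + s) * b ^ t)       ≡⟨ bin-cong u (λ s t _ → ℕ.*-distribʳ-+ (b ^ t) k s) ⟩
  bin u (λ s t → k * b ^ t + s * b ^ t) ≡⟨ bin-+ u _ _ ⟩
  bin u (λ s t → k * b ^ t) + bin u (λ s t → s * b ^ t)
    ≡⟨ cong₂ _+_ (trans (bin-* u k _) (cong (k *_) (bin-^ u b))) (bin-s u b) ⟩
  k * suc b ^ u + der (suc b) u         ∎
  where open ≡-Reasoning

-- Numbers of explorations from k active and u fresh vertices when no blocked
-- pair matters any more (C); from i and k other active vertices, with j and u
-- others fresh (X); from k active vertices, with i, j and u others fresh (D).
C X D : ℕ → ℕ → ℕ
C k zero    = 1
C k (suc u) = k * (k + suc u) ^ u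
X k u = k * (k + u + 2) ^ u + der (k + u + 2) u
D k u = k * (k + u) * (k + u + 2) ^ u

-- The factor k + t raises the exponent t - 1 to t and thereby merges the two clauses of `C`.
*-C : ∀ k t → (k + t) * C k t ≡ k * (k + t) ^ t
*-C k zero    = trans (ℕ.*-identityʳ (k + 0)) (trans (ℕ.+-identityʳ k) (sym (ℕ.*-identityʳ k)))
*-C k (suc t) = lemma k (k + suc t) ((k + suc t) ^ t)
  where
  lemma : ∀ k b x → b * (k * x) ≡ k * (b * x)
  lemma = solve-∀

regroup : ∀ k s t {u} → s + t ≡ u → k + s + t ≡ k + u
regroup k s t eq = trans (ℕ.+-assoc k s t) (cong (k +_) eq)

-- The recurrence behind Cayley's formula k (k + u)^(u - 1) for forests with k prescribed roots, on
-- removing one root. All summands share the base b = k + suc u; multiplying by b makes them affine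
-- in s times a power of b, and b is cancelled at the end.
bin-C : ∀ k u → bin (suc u) (λ s t → C (k + s) t) ≡ C (suc k) (suc u)
bin-C k u = ℕ.*-cancelˡ-≡ _ _ (k + suc u) ⦃ ≢-nonZero λ eq → ℕ.m+1+n≢0 k eq ⦄ (begin
  b * bin (suc u) (λ s t → C (k + s) t)    ≡⟨ bin-* (suc u) b (λ s t → C (k + s) t) ⟨
  bin (suc u) (λ s t → b * C (k + s) t)    ≡⟨ bin-cong (suc u) term ⟩
  bin (suc u) (λ s t → (k + s) * b ^ t)    ≡⟨ bin-affine (suc u) k b ⟩
  k * (suc b * suc b ^ u) + suc u * suc b ^ u ≡⟨ lemma k u (suc b ^ u) ⟩
  b * (suc k * suc b ^ u)                  ∎)
  where
  open ≡-Reasoning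
  b = k + suc u
  term : ∀ s t → s + t ≡ suc u → b * C (k + s) t ≡ (k + s) * b ^ t
  term s t eq = subst (λ x → x * C (k + s) t ≡ (k + s) * x ^ t) (regroup k s t eq) (*-C (k + s) t)
  lemma : ∀ k u x → k * (suc (k + suc u) * x) + suc u * x ≡ (k + suc u) * (suc k * x)
  lemma = solve-∀

-- Processing i first cannot discover j, which therefore stays among the fresh vertices: hence
-- `suc t`.
bin-X : ∀ k u → bin u (λ s t → C (k + s) (suc t)) ≡ X k u
bin-X k u = begin
  bin u (λ s t → (k + s) * (k + s + suc t) ^ t) ≡⟨ bin-cong u (λ s t eq → cong (λ x → (k + s) * x ^ t) (index s t eq)) ⟩
  bin u (λ s t → (k + s) * suc (k + u) ^ t)     ≡⟨ bin-affine u k (suc (k + u)) ⟩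
  k * (2 + (k + u)) ^ u + der (2 + (k + u)) u   ≡⟨ cong (λ b → k * b ^ u + der b u) (ℕ.+-comm 2 (k + u)) ⟩
  X k u                                         ∎
  where
  open ≡-Reasoning
  index : ∀ s t → s + t ≡ u → k + s + suc t ≡ suc (k + u)
  index s t eq = trans (ℕ.+-suc (k + s) t) (cong suc (regroup k s t eq))

C+der : ∀ k t → C (2 + k) t + der (k + t + 2) t ≡ (k + t + 2) ^ t
C+der k zero    = refl
C+der k (suc t) = trans (cong (λ b → (2 + k) * b ^ t + suc t * (k + suc t + 2) ^ t) (index k t))
  (lemma k t ((k + suc t + 2) ^ t))
  where
  index : ∀ k t → 2 + k + suc t ≡ k + suc t + 2
  index = solve-∀
  lemma : ∀ k t x → (2 + k) * x + suc t * x ≡ (k + suc t + 2) * x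
  lemma = solve-∀

-- The four terms are the continuations after a step that discovers neither, one or both of i and j.
-- All of them are reduced to the base b = k + t + 2, which is constant along the binomial sum.
D+2X+C : ∀ k t → D k t + (X k t + X k t + C (2 + k) t) ≡
         k * (k + t + 2) ^ suc t + (k + t + 2) ^ t + der (k + t + 2) t
D+2X+C k t = begin
  D k t + (X k t + X k t + C (2 + k) t) ≡⟨ lemma₁ k t (b ^ t) (der b t) (C (2 + k) t) ⟩
  k * (b * b ^ t) + (C (2 + k) t + der b t) + der b t ≡⟨ cong (λ x → k * (b * b ^ t) + x + der b t) (C+der k t) ⟩
  k * (b * b ^ t) + b ^ t + der b t ∎
  where
  open ≡-Reasoning
  b = k + t + 2
  lemma₁ : ∀ k t x y c → k * (k + t) * x + (k * x + y + (k * x + y) + c) ≡ k * ((k + t + 2) * x) + (c + y) + y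
  lemma₁ = solve-∀

-- The base b is independent of k and u because there are two uses: `bin-D` takes b = k + u + 2,
-- whereas `bin-total` takes k = 0 and the smaller b = u + 1.
bin-summand : ∀ u k b → bin u (λ s t → (k + s) * b ^ suc t + b ^ t + der b t) ≡ (b * k + u + 1) * suc b ^ u
bin-summand u k b = begin
  bin u (λ s t → (k + s) * b ^ suc t + b ^ t + der b t)
    ≡⟨ trans (bin-+ u _ _) (cong (_+ _) (bin-+ u _ _)) ⟩
  bin u (λ s t → (k + s) * b ^ suc t) + bin u (λ s t → b ^ t) + bin u (λ s t → der b t)
    ≡⟨ cong₂ _+_ (cong₂ _+_ (trans (bin-cong u λ s t _ → swap (k + s) b (b ^ t)) (trans (bin-* u b _) (cong (b *_) (bin-affine u k b)))) (bin-^ u b)) (bin-der u b) ⟩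
  b * (k * suc b ^ u + der (suc b) u) + suc b ^ u + der (suc b) u
    ≡⟨ lemma₁ b k (suc b ^ u) (der (suc b) u) ⟩
  b * k * suc b ^ u + suc b ^ u + suc b * der (suc b) u
    ≡⟨ cong (b * k * suc b ^ u + suc b ^ u +_) (*-der (suc b) u) ⟩
  b * k * suc b ^ u + suc b ^ u + u * suc b ^ u
    ≡⟨ lemma₂ b k u (suc b ^ u) ⟩
  (b * k + u + 1) * suc b ^ u ∎
  where
  open ≡-Reasoning
  swap : ∀ s b x → s * (b * x) ≡ b * (s * x)
  swap = solve-∀
  lemma₁ : ∀ b k x y → b * (k * x + y) + x + y ≡ b * k * x + x + suc b * y
  lemma₁ = solve-∀
  lemma₂ : ∀ b k u x → b * k * x + x + u * x ≡ (b * k + u + 1) * x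
  lemma₂ = solve-∀

-- The recurrence for processing one of suc k active vertices, with s counting the discovered
-- vertices other than i and j.
bin-D : ∀ k u → bin u (λ s t → D (k + s) t + (X (k + s) t + X (k + s) t + C (2 + (k + s)) t)) ≡ D (suc k) u
bin-D k u = begin
  bin u (λ s t → D (k + s) t + (X (k + s) t + X (k + s) t + C (2 + (k + s)) t))
    ≡⟨ bin-cong u (λ s t eq → trans (D+2X+C (k + s) t)
         (cong (λ b → (k + s) * b ^ suc t + b ^ t + der b t) (cong (_+ 2) (regroup k s t eq)))) ⟩
  bin u (λ s t → (k + s) * b ^ suc t + b ^ t + der b t) ≡⟨ bin-summand u k b ⟩
  (b * k + u + 1) * suc b ^ u ≡⟨ lemma k u (suc b ^ u) ⟩
  suc k * (suc k + u) * suc b ^ u ∎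
  where
  open ≡-Reasoning
  b = k + u + 2
  lemma : ∀ k u x → ((k + u + 2) * k + u + 1) * x ≡ suc k * (suc k + u) * x
  lemma = solve-∀

-- The joint contribution of the four Z with the same Y, for s elements in Y and t vertices outside
-- Y and {i, j}. In a nonempty Y one vertex is spent as the starting vertex of a parking function,
-- which lowers the index by one.
total : ℕ → ℕ → ℕ
total zero    t = 0
total (suc s) t = D s t + (X s t + X s t + C (2 + s) t)

-- Only the term s = 0 may differ, and its binomial coefficient is 1. The additive form avoids
-- subtraction.
bin-differ : ∀ u {φ ψ} → (∀ s t → suc s + t ≡ u → φ (suc s) t ≡ ψ (suc s) t) →
             bin u φ + ψ 0 u ≡ bin u ψ + φ 0 u
bin-differ zero    {φ} {ψ} eq = ℕ.+-comm (φ 0 0) (ψ 0 0)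
bin-differ (suc u) {φ} {ψ} eq = begin
  bin u _ + bin u (λ s t → φ s (suc t)) + ψ 0 (suc u) ≡⟨ ℕ.+-assoc (bin u _) _ _ ⟩
  bin u _ + (bin u (λ s t → φ s (suc t)) + ψ 0 (suc u))
    ≡⟨ cong₂ _+_ (bin-cong u λ s t e → eq s t (cong suc e))
                 (bin-differ u λ s t e → eq s (suc t) (trans (cong suc (ℕ.+-suc s t)) (cong suc e))) ⟩
  bin u _ + (bin u (λ s t → ψ s (suc t)) + φ 0 (suc u)) ≡⟨ ℕ.+-assoc (bin u _) _ _ ⟨
  bin u _ + bin u (λ s t → ψ s (suc t)) + φ 0 (suc u) ∎
  where open ≡-Reasoning

-- For k = -1 the identity `bin-D` would read 0, and its terms with s ≥ 1 are those of `total`. So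
-- the sum is minus the term at s = 0, namely N * N ^ M - N ^ M - M * N ^ m, which is N ^ m * M ^ 2
-- because N = M + 1. To stay within ℕ, N * N ^ t is added to every term, turning the coefficient s
-- - 1 into s, and `bin-differ` exchanges the terms at s = 0.
bin-total : ∀ m → bin (suc m) total ≡ (2 + m) ^ m * suc m ^ 2
bin-total m = ℕ.+-cancelʳ-≡ (N * Q + (N ^ M + der N M)) _ _ (begin
  bin M total + (N * Q + (N ^ M + der N M))
    ≡⟨ ℕ.+-assoc (bin M total) (N * Q) _ ⟨
  bin M total + N * Q + (N ^ M + der N M)
    ≡⟨ cong (λ x → bin M total + x + (N ^ M + der N M)) (trans (bin-* M N (λ s t → N ^ t)) (cong (N *_) (bin-^ M N))) ⟨
  bin M total + bin M (λ s t → N * N ^ t) + (N ^ M + der N M)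
    ≡⟨ cong (_+ (N ^ M + der N M)) (bin-+ M total (λ s t → N * N ^ t)) ⟨
  bin M (λ s t → total s t + N * N ^ t) + (N ^ M + der N M)
    ≡⟨ bin-differ M {λ s t → s * N ^ suc t + N ^ t + der N t} {λ s t → total s t + N * N ^ t} term ⟨
  bin M (λ s t → s * N ^ suc t + N ^ t + der N t) + N * N ^ M
    ≡⟨ cong (_+ N * N ^ M) (bin-summand M 0 N) ⟩
  (N * 0 + M + 1) * Q + N * N ^ M
    ≡⟨ lemma m Q (N ^ m) ⟩
  N ^ m * suc m ^ 2 + (N * Q + (N ^ M + der N M)) ∎)
  where
  open ≡-Reasoning
  N = 2 + m
  M = suc m
  Q = suc N ^ M
  shift′ : ∀ s a b c → (a + s * a) + b + c ≡ s * a + b + c + a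
  shift′ = solve-∀
  term : ∀ s t → suc s + t ≡ M →
         suc s * N ^ suc t + N ^ t + der N t ≡ total (suc s) t + N * N ^ t
  term s t eq = trans (shift′ s (N ^ suc t) (N ^ t) (der N t))
    (cong (_+ N * N ^ t) (sym (subst (λ b → total (suc s) t ≡ s * b ^ suc t + b ^ t + der b t)
      (trans (ℕ.+-comm (s + t) 2) (cong suc eq)) (D+2X+C s t))))
  lemma : ∀ m q y → ((2 + m) * 0 + suc m + 1) * q + (2 + m) * ((2 + m) * y) ≡
                    y * (suc m * (suc m * 1)) + ((2 + m) * q + ((2 + m) * y + suc m * y))
  lemma = solve-∀

-- This identity matches the two families: the left side is what parking functions contribute for Z
-- containing j alone and for Z containing both, the right side what trees contribute for j alone.
X+C : ∀ s t → X s t + C (2 + s) t ≡ C (suc s) (suc t)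
X+C s t = begin
  s * b ^ t + der b t + C (2 + s) t   ≡⟨ lemma s (b ^ t) (der b t) (C (2 + s) t) ⟩
  s * b ^ t + (C (2 + s) t + der b t) ≡⟨ cong (s * b ^ t +_) (C+der s t) ⟩
  s * b ^ t + b ^ t                   ≡⟨ ℕ.+-comm (s * b ^ t) _ ⟩
  suc s * b ^ t                       ≡⟨ cong (λ x → suc s * x ^ t) (index s t) ⟩
  suc s * (suc s + suc t) ^ t         ∎
  where
  open ≡-Reasoning
  b = s + t + 2
  lemma : ∀ s x y c → s * x + y + c ≡ s * x + (c + y)
  lemma = solve-∀
  index : ∀ s t → s + t + 2 ≡ suc s + suc t
  index = solve-∀

-- Sums over subsets as binomial sums

Σ⊆-bin : ∀ {n} (Q : Subset n) φ → Σ⊆ Q (λ S → φ ∣ S ∣ ∣ Q ─ S ∣) ≡ bin ∣ Q ∣ φ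
Σ⊆-bin []            φ = refl
Σ⊆-bin (outside ∷ Q) φ = trans (Σ⊆-cong Q λ S _ → refl) (Σ⊆-bin Q φ)
Σ⊆-bin (inside ∷ Q)  φ = cong₂ _+_ (Σ⊆-bin Q _) (Σ⊆-bin Q _)

-- The summand may depend on whether i lies in S. Setting i apart leaves a binomial sum over the
-- other m elements, in which i adds one either to s or to t.
Σ⊆-bin₁ : ∀ {n} (Q : Subset n) i → lookup Q i ≡ true → ∀ {m} → ∣ Q ∣ ≡ suc m →
          ∀ (φ : Bool → ℕ → ℕ → ℕ) →
          Σ⊆ Q (λ S → φ (lookup S i) ∣ S ∣ ∣ Q ─ S ∣) ≡
          bin m (λ s t → φ true (suc s) t + φ false s (suc t))
Σ⊆-bin₁ (true ∷ Q)  zero    h {m} e φ = begin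
  Σ⊆ Q (λ S → φ true (suc ∣ S ∣) ∣ Q ─ S ∣) + Σ⊆ Q (λ S → φ false ∣ S ∣ (suc ∣ Q ─ S ∣))
    ≡⟨ cong₂ _+_ (Σ⊆-bin Q (φ₁ true)) (Σ⊆-bin Q (φ₂ false)) ⟩
  bin (∣ Q ∣) (φ₁ true) + bin (∣ Q ∣) (φ₂ false)
    ≡⟨ cong (λ u → bin u (φ₁ true) + bin u (φ₂ false)) (ℕ.suc-injective e) ⟩
  bin m (φ₁ true) + bin m (φ₂ false) ≡⟨ bin-+ m (φ₁ true) (φ₂ false) ⟨
  bin m (λ s t → φ true (suc s) t + φ false s (suc t)) ∎
  where
  open ≡-Reasoning
  φ₁ φ₂ : Bool → ℕ → ℕ → ℕ
  φ₁ x s t = φ x (suc s) t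
  φ₂ x s t = φ x s (suc t)
Σ⊆-bin₁ (false ∷ Q) (suc i) h e φ = Σ⊆-bin₁ Q i h e φ
Σ⊆-bin₁ (true ∷ Q)  (suc i) h {zero}  e φ with () ← trans (sym (∣delete∣ Q i h)) (ℕ.suc-injective e)
Σ⊆-bin₁ (true ∷ Q)  (suc i) h {suc m} e φ = cong₂ _+_
  (Σ⊆-bin₁ Q i h (ℕ.suc-injective e) λ x s t → φ x (suc s) t)
  (Σ⊆-bin₁ Q i h (ℕ.suc-injective e) λ x s t → φ x s (suc t))

-- The four traces of S on {i, j} taken together; s and t count only the elements other than i and
-- j.
bin₂ : (Bool → Bool → ℕ → ℕ → ℕ) → ℕ → ℕ → ℕ
bin₂ φ s t = φ true true (2 + s) t + φ true false (suc s) (suc t)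
           + (φ false true (suc s) (suc t) + φ false false s (2 + t))

Σ⊆-bin₂ : ∀ {n} (Q : Subset n) i j → i ≢ j → lookup Q i ≡ true → lookup Q j ≡ true →
          ∀ {m} → ∣ Q ∣ ≡ 2 + m → ∀ φ →
          Σ⊆ Q (λ S → φ (lookup S i) (lookup S j) ∣ S ∣ ∣ Q ─ S ∣) ≡ bin m (bin₂ φ)
Σ⊆-bin₂ Q           zero    zero    i≢j hi hj e φ = contradiction refl i≢j
Σ⊆-bin₂ (true ∷ Q)  zero    (suc j) i≢j hi hj {m} e φ = trans
  (cong₂ _+_ (Σ⊆-bin₁ Q j hj (ℕ.suc-injective e) λ y s t → φ true y (suc s) t)
             (Σ⊆-bin₁ Q j hj (ℕ.suc-injective e) λ y s t → φ false y s (suc t)))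
  (sym (bin-+ m (λ s t → φ true true (2 + s) t + φ true false (suc s) (suc t))
                (λ s t → φ false true (suc s) (suc t) + φ false false s (2 + t))))
Σ⊆-bin₂ (true ∷ Q)  (suc i) zero    i≢j hi hj {m} e φ = trans
  (cong₂ _+_ (Σ⊆-bin₁ Q i hi (ℕ.suc-injective e) λ x s t → φ x true (suc s) t)
             (Σ⊆-bin₁ Q i hi (ℕ.suc-injective e) λ x s t → φ x false s (suc t)))
  (trans (sym (bin-+ m (λ s t → φ true true (2 + s) t + φ false true (suc s) (suc t))
                       (λ s t → φ true false (suc s) (suc t) + φ false false s (2 + t))))
    (bin-cong m λ s t _ → interchange (φ true true (2 + s) t) (φ false true (suc s) (suc t))
                            (φ true false (suc s) (suc t)) (φ false false s (2 + t))))
Σ⊆-bin₂ (false ∷ Q) (suc i) (suc j) i≢j hi hj e φ = Σ⊆-bin₂ Q i j (i≢j ∘ cong suc) hi hj e φ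
Σ⊆-bin₂ (true ∷ Q)  (suc i) (suc j) i≢j hi hj {zero}  e φ
  with () ← trans (sym (trans (∣delete∣ Q i hi) (cong suc (∣delete∣ (delete Q i) j
                (trans (lookup-delete′ Q (i≢j ∘ cong suc ∘ sym)) hj))))) (ℕ.suc-injective e)
Σ⊆-bin₂ (true ∷ Q)  (suc i) (suc j) i≢j hi hj {suc m} e φ = cong₂ _+_
  (Σ⊆-bin₂ Q i j (i≢j ∘ cong suc) hi hj (ℕ.suc-injective e) λ x y s t → φ x y (suc s) t)
  (Σ⊆-bin₂ Q i j (i≢j ∘ cong suc) hi hj (ℕ.suc-injective e) λ x y s t → φ x y s (suc t))

-- Explorations

data Status : Set where
  done active fresh : Status

isDone isActive isFresh : Status → Bool
isDone done     = true
isDone _        = false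
isActive active = true
isActive _      = false
isFresh fresh   = true
isFresh _       = false

isActive⇒ : ∀ {s} → isActive s ≡ true → s ≡ active
isActive⇒ {active} _ = refl

isFresh⇒ : ∀ {s} → isFresh s ≡ true → s ≡ fresh
isFresh⇒ {fresh} _ = refl

isDone⇒ : ∀ {s} → isDone s ≡ true → s ≡ done
isDone⇒ {done} _ = refl

does-true : ∀ {a} {A : Set a} (a? : Dec A) → does a? ≡ true → A
does-true (yes a) _ = a

module _ {n p} {P : Fin n → Set p} (P? : ∀ v → Dec (P v)) where

  select : Subset n
  select = tabulate (does ∘ P?)

  select⇒ : ∀ v → lookup select v ≡ true → P v
  select⇒ v h = does-true (P? v) (trans (sym (lookup∘tabulate (does ∘ P?) v)) h)

  select⇐ : ∀ v → P v → lookup select v ≡ true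
  select⇐ v pv = trans (lookup∘tabulate (does ∘ P?) v) (dec-true (P? v) pv)

true≢false : true ≢ false
true≢false ()

card-cong : ∀ {a p} {A : Set a} {P : Pred A p} {M N} → M ≡ N → Card P M → Card P N
card-cong refl c = c

∣delete─∣ : ∀ {n} (A S : Subset n) v → lookup A v ≡ true → lookup S v ≡ false →
            ∣ A ─ S ∣ ≡ suc ∣ delete A v ─ S ∣
∣delete─∣ (true ∷ A)  (false ∷ S) zero    hA hS = refl
∣delete─∣ (true ∷ A)  (false ∷ S) (suc v) hA hS = cong suc (∣delete─∣ A S v hA hS)
∣delete─∣ (true ∷ A)  (true ∷ S)  (suc v) hA hS = ∣delete─∣ A S v hA hS
∣delete─∣ (false ∷ A) (false ∷ S) (suc v) hA hS = ∣delete─∣ A S v hA hS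
∣delete─∣ (false ∷ A) (true ∷ S)  (suc v) hA hS = ∣delete─∣ A S v hA hS

∣∣≡0⇒∉ : ∀ {n} {A : Subset n} {v} → ∣ A ∣ ≡ 0 → ¬ lookup A v ≡ true
∣∣≡0⇒∉ {A = A} {v} e h = true≢false (trans (sym h) (∣∣≡0⇒empty A e v))

∣∣≡1⇒unique : ∀ {n} {A : Subset n} {u v} → ∣ A ∣ ≡ 1 → lookup A u ≡ true → lookup A v ≡ true → u ≡ v
∣∣≡1⇒unique {A = A} {u} {v} e hu hv with u Fin.≟ v
... | yes u≡v = u≡v
... | no u≢v  = contradiction (trans (lookup-delete′ A u≢v) hu)
  (∣∣≡0⇒∉ {A = delete A v} {u} (ℕ.suc-injective (trans (sym (∣delete∣ A v hv)) e)))

State : ℕ → Set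
State n = Fin n → Status

module _ {n : ℕ} where

  actives freshs : State n → Subset n
  actives σ = tabulate (isActive ∘ σ)
  freshs σ  = tabulate (isFresh ∘ σ)

  freshs⇒ : ∀ σ v → lookup (freshs σ) v ≡ true → σ v ≡ fresh
  freshs⇒ σ v h = isFresh⇒ (trans (sym (lookup∘tabulate _ v)) h)

  freshs⇐ : ∀ σ v → σ v ≡ fresh → lookup (freshs σ) v ≡ true
  freshs⇐ σ v h = trans (lookup∘tabulate _ v) (cong isFresh h)

  -- Processes p, discovering S.
  advance : State n → Fin n → Subset n → State n
  advance σ p S v = if lookup S v then active else if does (v Fin.≟ p) then done else σ v

  advance-∈ : ∀ σ p S {v} → lookup S v ≡ true → advance σ p S v ≡ active
  advance-∈ σ p S {v} h rewrite h = refl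

  advance-self : ∀ σ p S → lookup S p ≡ false → advance σ p S p ≡ done
  advance-self σ p S h rewrite h | dec-true (p Fin.≟ p) refl = refl

  advance-∉ : ∀ σ p S {v} → lookup S v ≡ false → v ≢ p → advance σ p S v ≡ σ v
  advance-∉ σ p S {v} h v≢p rewrite h | dec-false (v Fin.≟ p) v≢p = refl

  data Advanced (σ : State n) (p : Fin n) (S : Subset n) (v : Fin n) : Set where
    discovered : lookup S v ≡ true → advance σ p S v ≡ active → Advanced σ p S v
    processed  : lookup S v ≡ false → v ≡ p → advance σ p S v ≡ done → Advanced σ p S v
    unchanged  : lookup S v ≡ false → v ≢ p → advance σ p S v ≡ σ v → Advanced σ p S v

  advanced : ∀ σ p S v → Advanced σ p S v
  advanced σ p S v with lookup S v in h | v Fin.≟ p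
  ... | true  | _        = discovered h (advance-∈ σ p S h)
  ... | false | yes refl = processed h refl (advance-self σ p S h)
  ... | false | no v≢p   = unchanged h v≢p (advance-∉ σ p S h v≢p)

  advance-fresh : ∀ σ p S v → advance σ p S v ≡ fresh → lookup S v ≡ false × v ≢ p × σ v ≡ fresh
  advance-fresh σ p S v h with advanced σ p S v
  ... | discovered _ e    = contradiction (trans (sym e) h) λ ()
  ... | processed _ _ e   = contradiction (trans (sym e) h) λ ()
  ... | unchanged v∉ v≢ e = v∉ , v≢ , trans (sym e) h

  freshs-advance : ∀ σ p S → σ p ≡ active → freshs (advance σ p S) ≡ freshs σ ─ S
  freshs-advance σ p S σp = vec-ext λ v → trans (lookup∘tabulate _ v) (trans (eq v) (sym (lookup-─ (freshs σ) S v)))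
    where
    eq : ∀ v → isFresh (advance σ p S v) ≡ (if lookup S v then false else lookup (freshs σ) v)
    eq v with advanced σ p S v
    ... | discovered v∈ e    rewrite v∈ | e = refl
    ... | processed v∉ refl e rewrite v∉ | e | lookup∘tabulate (isFresh ∘ σ) p | σp = refl
    ... | unchanged v∉ _ e   rewrite v∉ | e | lookup∘tabulate (isFresh ∘ σ) v = refl

  actives-advance : ∀ σ p S → actives (advance σ p S) ≡ delete (actives σ) p ∪ S
  actives-advance σ p S = vec-ext λ v → trans (lookup∘tabulate _ v)
    (trans (eq v) (sym (lookup-zipWith _∨_ v (delete (actives σ) p) S)))
    where
    eq : ∀ v → isActive (advance σ p S v) ≡ lookup (delete (actives σ) p) v ∨ lookup S v
    eq v with advanced σ p S v
    ... | discovered v∈ e     rewrite v∈ | e = sym (Bool.∨-zeroʳ _)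
    ... | processed v∉ refl e rewrite v∉ | e | lookup-delete (actives σ) p = refl
    ... | unchanged v∉ v≢p e  rewrite v∉ | e | lookup-delete′ (actives σ) v≢p | lookup∘tabulate (isActive ∘ σ) v =
      sym (Bool.∨-identityʳ _)

  ∣actives-advance∣ : ∀ σ p S {k} → σ p ≡ active → S ⊑ freshs σ → ∣ actives σ ∣ ≡ suc k →
                      ∣ actives (advance σ p S) ∣ ≡ k + ∣ S ∣
  ∣actives-advance∣ σ p S {k} σp S⊑ e = begin
    ∣ actives (advance σ p S) ∣      ≡⟨ cong ∣_∣ (actives-advance σ p S) ⟩
    ∣ delete (actives σ) p ∪ S ∣     ≡⟨ ∣disjoint∪∣ (delete (actives σ) p) S disjoint ⟩
    ∣ delete (actives σ) p ∣ + ∣ S ∣ ≡⟨ cong (_+ ∣ S ∣) (ℕ.suc-injective (trans (sym (∣delete∣ (actives σ) p p∈)) e)) ⟩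
    k + ∣ S ∣                        ∎
    where
    open ≡-Reasoning
    p∈ : lookup (actives σ) p ≡ true
    p∈ = trans (lookup∘tabulate _ p) (cong isActive σp)
    disjoint : ∀ v → lookup S v ≡ true → lookup (delete (actives σ) p) v ≡ false
    disjoint v v∈S with v Fin.≟ p
    ... | yes refl = lookup-delete (actives σ) p
    ... | no v≢p   = trans (lookup-delete′ (actives σ) v≢p)
      (trans (lookup∘tabulate _ v) (cong isActive (freshs⇒ σ v (S⊑ v v∈S))))

  initial : Fin n → State n
  initial r v = if does (v Fin.≟ r) then active else fresh

  initial-self : ∀ r → initial r r ≡ active
  initial-self r rewrite dec-true (r Fin.≟ r) refl = refl

  initial-other : ∀ {r v} → v ≢ r → initial r v ≡ fresh
  initial-other {r} {v} v≢r rewrite dec-false (v Fin.≟ r) v≢r = refl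

  initial-fresh : ∀ {r v} → initial r v ≡ fresh → v ≢ r
  initial-fresh {r} h refl = contradiction (trans (sym (initial-self r)) h) λ ()

  -- The state after the first step, in which r discovers the rest of Z; thus Z is r together with
  -- what r discovers.
  start : Fin n → Subset n → State n
  start r Z = advance (initial r) r (delete Z r)

  module _ (r : Fin n) (Z : Subset n) where

    start-self : start r Z r ≡ done
    start-self = advance-self (initial r) r (delete Z r) (lookup-delete Z r)

    start-∈ : ∀ {v} → lookup Z v ≡ true → v ≢ r → start r Z v ≡ active
    start-∈ v∈ v≢r = advance-∈ (initial r) r (delete Z r) (trans (lookup-delete′ Z v≢r) v∈)

    start-∉ : ∀ {v} → lookup Z v ≡ false → v ≢ r → start r Z v ≡ fresh
    start-∉ v∉ v≢r = trans (advance-∉ (initial r) r (delete Z r) (trans (lookup-delete′ Z v≢r) v∉) v≢r)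
      (initial-other v≢r)

    start-fresh : ∀ {v} → lookup Z r ≡ true → start r Z v ≡ fresh → lookup Z v ≡ false
    start-fresh {v} r∈ h =
      let (v∉ , v≢r , _) = advance-fresh (initial r) r (delete Z r) v h in trans (sym (lookup-delete′ Z v≢r)) v∉

    freshs-start : lookup Z r ≡ true → freshs (start r Z) ≡ ∁ Z
    freshs-start r∈ = vec-ext λ v →
      trans (lookup∘tabulate _ v) (trans (eq v (v Fin.≟ r) (lookup Z v) refl) (sym (lookup-∁ Z v)))
      where
      eq : ∀ v → Dec (v ≡ r) → ∀ b → lookup Z v ≡ b → isFresh (start r Z v) ≡ not (lookup Z v)
      eq v (yes refl) _     h rewrite r∈ = cong isFresh start-self
      eq v (no v≢r)   true  h rewrite h  = cong isFresh (start-∈ h v≢r)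
      eq v (no v≢r)   false h rewrite h  = cong isFresh (start-∉ h v≢r)

    actives-start : actives (start r Z) ≡ delete Z r
    actives-start = vec-ext λ v → trans (lookup∘tabulate _ v) (eq v (v Fin.≟ r) (lookup Z v) refl)
      where
      eq : ∀ v → Dec (v ≡ r) → ∀ b → lookup Z v ≡ b → isActive (start r Z v) ≡ lookup (delete Z r) v
      eq v (yes refl) _     h = trans (cong isActive start-self) (sym (lookup-delete Z r))
      eq v (no v≢r)   true  h = trans (cong isActive (start-∈ h v≢r)) (sym (trans (lookup-delete′ Z v≢r) h))
      eq v (no v≢r)   false h = trans (cong isActive (start-∉ h v≢r)) (sym (trans (lookup-delete′ Z v≢r) h))

    ∣actives-start∣ : ∀ {k} → lookup Z r ≡ true → ∣ Z ∣ ≡ suc k → ∣ actives (start r Z) ∣ ≡ k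
    ∣actives-start∣ r∈ e = trans (cong ∣_∣ actives-start) (ℕ.suc-injective (trans (sym (∣delete∣ Z r r∈)) e))

    ∣freshs-start∣ : lookup Z r ≡ true → ∣ freshs (start r Z) ∣ ≡ ∣ ∁ Z ∣
    ∣freshs-start∣ r∈ = cong ∣_∣ (freshs-start r∈)

module _ {n : ℕ} (i j : Fin n) where

  -- The pairs not joined by an edge of Kₙ − {i j}.
  Blocked : Fin n → Fin n → Set
  Blocked u v = (u ≡ i × v ≡ j) ⊎ (u ≡ j × v ≡ i)

  blocked? : ∀ u v → Dec (Blocked u v)
  blocked? u v = (u Fin.≟ i ×-dec v Fin.≟ j) ⊎-dec (u Fin.≟ j ×-dec v Fin.≟ i)

  blocked-pair : ∀ {u v u′ v′} → Blocked u v → Blocked u′ v′ → (u′ ≡ u × v′ ≡ v) ⊎ (u′ ≡ v × v′ ≡ u)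
  blocked-pair (inj₁ (refl , refl)) b                    = b
  blocked-pair (inj₂ (refl , refl)) b                    = Sum′.swap b

  -- w records, for each fresh vertex v, a value from which one can read off
  -- whether v is discovered when its active neighbour p is processed: it is
  -- if w v = mark σ p v. The exploration Complete σ w discovers all vertices.
  record System (Val : Set) : Set₁ where
    field
      _≟_      : DecidableEquality Val
      mark     : State n → Fin n → Fin n → Val
      Complete : State n → Vec Val n → Set

    Child : State n → Fin n → Vec Val n → Fin n → Set
    Child σ p w v = σ v ≡ fresh × ¬ Blocked p v × lookup w v ≡ mark σ p v

    field
      finished  : ∀ σ w → (∀ v → σ v ≢ fresh) → Complete σ w
      stuck     : ∀ σ w v → (∀ u → σ u ≢ active) → σ v ≡ fresh → ¬ Complete σ w
      -- With the next two fields this gives the bijection behind `card-advance`: a completion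
      -- survives the step that takes all children of p (`explore`), every completion after a step
      -- with some children is one before it (`unexplore`), and then S held all children, so it is
      -- determined by w (`maximal`).
      explore   : ∀ σ w p S → σ p ≡ active →
                  (∀ v → lookup S v ≡ true → Child σ p w v) →
                  (∀ v → Child σ p w v → lookup S v ≡ true) →
                  Complete σ w → Complete (advance σ p S) w
      unexplore : ∀ σ w p S → σ p ≡ active →
                  (∀ v → lookup S v ≡ true → Child σ p w v) →
                  Complete (advance σ p S) w → Complete σ w
      maximal   : ∀ σ w p S → σ p ≡ active →
                  (∀ v → lookup S v ≡ true → Child σ p w v) →
                  Complete (advance σ p S) w → ∀ v → Child σ p w v → lookup S v ≡ true

-- Counting the completions of a partial exploration

module Counting {n : ℕ} {i j : Fin n} (i≢j : i ≢ j) {Val : Set} (𝒮 : System i j Val) where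
  open System 𝒮

  -- The entries outside the fresh vertices are prescribed by w₀, so that only the values at fresh
  -- vertices are left to choose.
  Completion : State n → (Fin n → Val) → Vec Val n → Set
  Completion σ w₀ w = (∀ v → σ v ≢ fresh → lookup w v ≡ w₀ v) × Complete σ w

  children? : ∀ Q σ p w v → Dec (lookup Q v ≡ true × lookup w v ≡ mark σ p v)
  children? Q σ p w v = lookup Q v Bool.≟ true ×-dec (lookup w v ≟ mark σ p v)

  -- Here Q is the set of possible children of p. Any S ⊑ Q may occur, and it forces the entries on
  -- S to be the marks, which `marked` adds to the prescribed ones. The count of the remainder must
  -- not depend on the prescribed entries, hence the quantifier over w₁.
  card-advance : ∀ σ p w₀ Q (g : Subset n → ℕ) → σ p ≡ active →
    (∀ v → lookup Q v ≡ true → σ v ≡ fresh × ¬ Blocked i j p v) →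
    (∀ v → σ v ≡ fresh → ¬ Blocked i j p v → lookup Q v ≡ true) →
    (∀ S → S ⊑ Q → ∀ w₁ → Card (Completion (advance σ p S) w₁) (g S)) →
    Card (Completion σ w₀) (Σ⊆ Q g)
  card-advance σ p w₀ Q g σp Q⇒ Q⇐ c = card-⇔ combine split
    (card-Σ⊆ Q {K} (λ {S} {T} {w} → disjoint {S} {T} {w}) λ S S⊑Q → card-⇔ (S⊑Q ,_) proj₂ (c S S⊑Q (marked S)))
    where
    marked : Subset n → Fin n → Val
    marked S v = if lookup S v then mark σ p v else w₀ v

    -- The condition `S ⊑ Q` is repeated inside the fibre because `card-Σ⊆` asks for disjointness
    -- without it.
    K : Subset n → Vec Val n → Set
    K S w = S ⊑ Q × Completion (advance σ p S) (marked S) w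

    S⇒child : ∀ S w → K S w → ∀ v → lookup S v ≡ true → Child σ p w v
    S⇒child S w (S⊑Q , agree , _) v v∈S = proj₁ (Q⇒ v (S⊑Q v v∈S)) , proj₂ (Q⇒ v (S⊑Q v v∈S)) ,
      trans (agree v (λ e → contradiction (trans (sym (advance-∈ σ p S v∈S)) e) λ ()))
            (cong (λ b → if b then mark σ p v else w₀ v) v∈S)

    disjoint : ∀ {S T w} → K S w → K T w → S ≡ T
    disjoint {S} {T} {w} k l = ⊑-antisym
      (λ v v∈ → maximal σ w p T σp (S⇒child T w l) (proj₂ (proj₂ l)) v (S⇒child S w k v v∈))
      (λ v v∈ → maximal σ w p S σp (S⇒child S w k) (proj₂ (proj₂ k)) v (S⇒child T w l v v∈))

    combine : ∀ {w} → (∃ λ S → S ⊑ Q × K S w) → Completion σ w₀ w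
    combine {w} (S , S⊑Q , k@(_ , agree , cmp)) = agree′ , unexplore σ w p S σp (S⇒child S w k) cmp
      where
      agree′ : ∀ v → σ v ≢ fresh → lookup w v ≡ w₀ v
      agree′ v v≢fresh with lookup S v in h
      ... | true  = contradiction (proj₁ (Q⇒ v (S⊑Q v h))) v≢fresh
      ... | false = trans (agree v (v≢fresh ∘ proj₂ ∘ proj₂ ∘ advance-fresh σ p S v))
                          (cong (λ b → if b then mark σ p v else w₀ v) h)

    split : ∀ {w} → Completion σ w₀ w → ∃ λ S → S ⊑ Q × K S w
    split {w} (agree , cmp) = S , S⊑Q , S⊑Q , agree′ ,
      explore σ w p S σp (λ v h → let (q , e) = S⇒ v h in proj₁ (Q⇒ v q) , proj₂ (Q⇒ v q) , e)
                         (λ v (f , b , e) → select⇐ (children? Q σ p w) v (Q⇐ v f b , e)) cmp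
      where
      S = select (children? Q σ p w)
      S⇒ = select⇒ (children? Q σ p w)
      S⊑Q : S ⊑ Q
      S⊑Q v h = proj₁ (S⇒ v h)
      agree′ : ∀ v → advance σ p S v ≢ fresh → lookup w v ≡ marked S v
      agree′ v h with advanced σ p S v
      ... | discovered v∈ _    rewrite v∈ = proj₂ (S⇒ v v∈)
      ... | processed v∉ refl _ rewrite v∉ = agree v λ e → contradiction (trans (sym σp) e) λ ()
      ... | unchanged v∉ _ e   rewrite v∉ = agree v (h ∘ trans e)

  card-finished : ∀ σ w₀ → ∣ freshs σ ∣ ≡ 0 → Card (Completion σ w₀) 1
  card-finished σ w₀ e = card-singleton {x = tabulate w₀} ((λ v _ → lookup∘tabulate w₀ v) , finished σ _ none)
    (λ (agree , _) → vec-ext λ v → trans (agree v (none v)) (sym (lookup∘tabulate w₀ v)))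
    where
    none : ∀ v → σ v ≢ fresh
    none v h = ∣∣≡0⇒∉ {A = freshs σ} e (freshs⇐ σ v h)

  card-stuck : ∀ σ w₀ {u} → ∣ actives σ ∣ ≡ 0 → ∣ freshs σ ∣ ≡ suc u → Card (Completion σ w₀) 0
  card-stuck σ w₀ e f = let (v , hv) = ∣∣≡suc⇒nonempty (freshs σ) f in
    card-∅ λ (_ , cmp) → stuck σ _ v (λ u h → ∣∣≡0⇒∉ {A = actives σ} e (trans (lookup∘tabulate _ u) (cong isActive h)))
                               (freshs⇒ σ v hv) cmp

  -- The missing edge can no longer interfere: a fresh end of it has its other end already
  -- processed, so no later step meets the pair.
  Safe : State n → Set
  Safe σ = ∀ u v → Blocked i j u v → σ v ≡ fresh → σ u ≡ done

  safe-advance : ∀ σ p S → S ⊑ freshs σ → Safe σ → Safe (advance σ p S)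
  safe-advance σ p S S⊑ safe u v b h
    with σu ← safe u v b (proj₂ (proj₂ (advance-fresh σ p S v h))) | advanced σ p S u
  ... | discovered u∈ _  = contradiction (trans (sym (freshs⇒ σ u (S⊑ u u∈))) σu) λ ()
  ... | processed _ _ e  = e
  ... | unchanged _ _ e  = trans e σu

  pick-active : ∀ (σ : State n) {k} → ∣ actives σ ∣ ≡ suc k → ∃ λ p → σ p ≡ active
  pick-active σ e = let (p , h) = ∣∣≡suc⇒nonempty (actives σ) e in p , isActive⇒ (trans (sym (lookup∘tabulate _ p)) h)

  ∣freshs-advance∣ : ∀ (σ : State n) p S → σ p ≡ active → ∣ freshs (advance σ p S) ∣ ≡ ∣ freshs σ ─ S ∣
  ∣freshs-advance∣ σ p S σp = cong ∣_∣ (freshs-advance σ p S σp)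

  -- The measure is the number of vertices not yet done; processing p lowers it by one, whatever S
  -- is.
  fuel-advance : ∀ {fuel k u} (Q S : Subset n) → suc k + u ≤ suc fuel → ∣ Q ∣ ≡ u → S ⊑ Q →
                 k + ∣ S ∣ + ∣ Q ─ S ∣ ≤ fuel
  fuel-advance {k = k} Q S (s≤s le) refl S⊑Q = ℕ.≤-trans (ℕ.≤-reflexive (regroup k ∣ S ∣ ∣ Q ─ S ∣ (∣─∣ Q S S⊑Q))) le

  -- In a safe state no active p is blocked from a fresh vertex, so S ranges over all sets of fresh
  -- vertices and the next state is safe again.
  card-C : ∀ fuel k u σ w₀ → k + u ≤ fuel → Safe σ → ∣ actives σ ∣ ≡ k → ∣ freshs σ ∣ ≡ u →
           Card (Completion σ w₀) (C k u)
  card-C _          k       zero    σ w₀ le safe ea ef = card-finished σ w₀ ef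
  card-C _          zero    (suc u) σ w₀ le safe ea ef = card-stuck σ w₀ ea ef
  card-C (suc fuel) (suc k) (suc u) σ w₀ le safe ea ef = card-cong
    (trans (Σ⊆-bin Q λ s t → C (k + s) t) (trans (cong (λ u → bin u λ s t → C (k + s) t) ef) (bin-C k u)))
    (card-advance σ p w₀ Q _ σp
      (λ v h → freshs⇒ σ v h , λ b → contradiction (trans (sym σp) (safe p v b (freshs⇒ σ v h))) λ ())
      (λ v h _ → freshs⇐ σ v h)
      λ S S⊑Q w₁ → card-C fuel _ _ _ w₁ (fuel-advance Q S le ef S⊑Q) (safe-advance σ p S S⊑Q safe)
        (∣actives-advance∣ σ p S σp S⊑Q ea) (∣freshs-advance∣ σ p S σp))
    where
    Q = freshs σ
    p = proj₁ (pick-active σ ea)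
    σp = proj₂ (pick-active σ ea)

  card-X : ∀ i′ j′ k u σ w₀ → Blocked i j i′ j′ → σ i′ ≡ active → σ j′ ≡ fresh →
           ∣ actives σ ∣ ≡ suc k → ∣ freshs σ ∣ ≡ suc u → Card (Completion σ w₀) (X k u)
  card-X i′ j′ k u σ w₀ b σi σj ea ef = card-cong
    (trans (Σ⊆-bin Q λ s t → C (k + s) (suc t))
      (trans (cong (λ u → bin u λ s t → C (k + s) (suc t))
               (ℕ.suc-injective (trans (sym (∣delete∣ (freshs σ) j′ (freshs⇐ σ j′ σj))) ef)))
        (bin-X k u)))
    (card-advance σ i′ w₀ Q _ σi
      (λ v h → let (v≢j , h′) = lookup-delete⁻ (freshs σ) v j′ h in freshs⇒ σ v h′ ,
        λ b′ → [ v≢j ∘ proj₂ , (λ (i≡j , _) → i′≢j′ i≡j) ]′ (blocked-pair i j b b′))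
      (λ v h ¬b → trans (lookup-delete′ (freshs σ) {v} {j′} λ { refl → ¬b b }) (freshs⇐ σ v h))
      λ S S⊑Q w₁ → card-C _ _ _ _ w₁ ℕ.≤-refl (safe S S⊑Q)
        (∣actives-advance∣ σ i′ S σi (S⊑freshs S S⊑Q) ea)
        (trans (∣freshs-advance∣ σ i′ S σi) (∣delete─∣ (freshs σ) S j′ (freshs⇐ σ j′ σj) (j∉ S S⊑Q))))
    where
    Q = delete (freshs σ) j′

    i′≢j′ : i′ ≢ j′
    i′≢j′ e = contradiction (trans (sym σi) (trans (cong σ e) σj)) λ ()

    S⊑freshs : ∀ S → S ⊑ Q → S ⊑ freshs σ
    S⊑freshs S S⊑Q v h = proj₂ (lookup-delete⁻ (freshs σ) v j′ (S⊑Q v h))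

    j∉ : ∀ S → S ⊑ Q → lookup S j′ ≡ false
    j∉ S S⊑Q with lookup S j′ in h
    ... | false = refl
    ... | true  = contradiction refl (proj₁ (lookup-delete⁻ (freshs σ) j′ j′ (S⊑Q j′ h)))

    safe : ∀ S → S ⊑ Q → Safe (advance σ i′ S)
    safe S S⊑Q u v b′ h with blocked-pair i j b b′ | advance-fresh σ i′ S v h
    ... | inj₂ (_ , refl) | (_ , v≢i , _) = contradiction refl v≢i
    ... | inj₁ (refl , _) | _ with advanced σ i′ S i′
    ...   | discovered i∈ _    = contradiction (trans (sym (freshs⇒ σ i′ (S⊑freshs S S⊑Q i′ i∈))) σi) λ ()
    ...   | processed _ _ e    = e
    ...   | unchanged _ i≢i _  = contradiction refl i≢i

  -- The arguments are the number of other active vertices, whether i and j lie in S, the size of S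
  -- and the number of vertices left fresh. The last clause fills in impossible sizes.
  countD : ℕ → Bool → Bool → ℕ → ℕ → ℕ
  countD k true  true  s       t             = C (k + s) t
  countD k true  false (suc s) (suc t)       = X (k + s) t
  countD k false true  (suc s) (suc t)       = X (k + s) t
  countD k false false s       (suc (suc t)) = D (k + s) t
  countD _ _     _     _       _             = 0

  bin-countD : ∀ k u → bin u (bin₂ (countD k)) ≡ D (suc k) u
  bin-countD k u = trans (bin-cong u λ s t _ → eq s t) (bin-D k u)
    where
    index : ∀ k s → k + (2 + s) ≡ 2 + (k + s)
    index = solve-∀
    reorder : ∀ c x d → c + x + (x + d) ≡ d + (x + x + c)
    reorder = solve-∀
    eq : ∀ s t → bin₂ (countD k) s t ≡ D (k + s) t + (X (k + s) t + X (k + s) t + C (2 + (k + s)) t)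
    eq s t = trans (cong (λ x → C x t + X (k + s) t + (X (k + s) t + D (k + s) t)) (index k s))
      (reorder (C (2 + (k + s)) t) (X (k + s) t) (D (k + s) t))

  -- While i and j are fresh, the active p is neither of them and nothing is blocked. Discovering
  -- both makes the state safe; discovering just one leads to `card-X`.
  card-D : ∀ fuel k u σ w₀ → k + (2 + u) ≤ fuel → σ i ≡ fresh → σ j ≡ fresh →
           ∣ actives σ ∣ ≡ k → ∣ freshs σ ∣ ≡ 2 + u → Card (Completion σ w₀) (D k u)
  card-D _          zero    u σ w₀ le σi σj ea ef = card-stuck σ w₀ ea ef
  card-D (suc fuel) (suc k) u σ w₀ le σi σj ea ef = card-cong
    (trans (Σ⊆-bin₂ Q i j i≢j (freshs⇐ σ i σi) (freshs⇐ σ j σj) ef (countD k)) (bin-countD k u))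
    (card-advance σ p w₀ Q _ σp
      (λ v h → freshs⇒ σ v h , λ { (inj₁ (p≡i , _)) → p≢ (trans (cong σ p≡i) σi)
                                 ; (inj₂ (p≡j , _)) → p≢ (trans (cong σ p≡j) σj) })
      (λ v h _ → freshs⇐ σ v h)
      λ S S⊑Q w₁ → by-cases S S⊑Q w₁ _ _ _ _ refl refl refl refl)
    where
    Q = freshs σ
    p = proj₁ (pick-active σ ea)
    σp = proj₂ (pick-active σ ea)

    p≢ : σ p ≢ fresh
    p≢ h = contradiction (trans (sym σp) h) λ ()

    module _ (S : Subset n) (S⊑Q : S ⊑ Q) (w₁ : Fin n → Val) where
      still-fresh : ∀ {v} → lookup S v ≡ false → σ v ≡ fresh → advance σ p S v ≡ fresh
      still-fresh {v} v∉ σv = trans (advance-∉ σ p S {v} v∉ λ { refl → p≢ σv }) σv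

      ∈─ : ∀ {v} → lookup S v ≡ false → σ v ≡ fresh → lookup (Q ─ S) v ≡ true
      ∈─ {v} v∉ σv = trans (lookup-─ Q S v) (trans (cong (λ b → if b then false else lookup Q v) v∉) (freshs⇐ σ v σv))

      by-cases : ∀ x y s t → lookup S i ≡ x → lookup S j ≡ y → ∣ S ∣ ≡ s → ∣ Q ─ S ∣ ≡ t →
                 Card (Completion (advance σ p S) w₁) (countD k x y s t)
      by-cases true true s t hi hj refl refl = card-C _ _ _ _ w₁ ℕ.≤-refl
        (λ { u v (inj₁ (_ , refl)) e → contradiction (trans (sym (advance-∈ σ p S {v} hj)) e) λ ()
           ; u v (inj₂ (_ , refl)) e → contradiction (trans (sym (advance-∈ σ p S {v} hi)) e) λ () })
        (∣actives-advance∣ σ p S σp S⊑Q ea) (∣freshs-advance∣ σ p S σp)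
      by-cases true false zero t hi hj es et = contradiction hi (∣∣≡0⇒∉ {A = S} es)
      by-cases true false (suc s) zero hi hj es et = contradiction (∈─ hj σj) (∣∣≡0⇒∉ {A = Q ─ S} et)
      by-cases true false (suc s) (suc t) hi hj es et = card-X i j _ _ _ w₁ (inj₁ (refl , refl))
        (advance-∈ σ p S hi) (still-fresh hj σj)
        (trans (∣actives-advance∣ σ p S σp S⊑Q ea) (trans (cong (k +_) es) (ℕ.+-suc k s)))
        (trans (∣freshs-advance∣ σ p S σp) et)
      by-cases false true zero t hi hj es et = contradiction hj (∣∣≡0⇒∉ {A = S} es)
      by-cases false true (suc s) zero hi hj es et = contradiction (∈─ hi σi) (∣∣≡0⇒∉ {A = Q ─ S} et)
      by-cases false true (suc s) (suc t) hi hj es et = card-X j i _ _ _ w₁ (inj₂ (refl , refl))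
        (advance-∈ σ p S hj) (still-fresh hi σi)
        (trans (∣actives-advance∣ σ p S σp S⊑Q ea) (trans (cong (k +_) es) (ℕ.+-suc k s)))
        (trans (∣freshs-advance∣ σ p S σp) et)
      by-cases false false s zero hi hj es et = contradiction (∈─ hi σi) (∣∣≡0⇒∉ {A = Q ─ S} et)
      by-cases false false s (suc zero) hi hj es et =
        contradiction (∣∣≡1⇒unique {A = Q ─ S} et (∈─ hi σi) (∈─ hj σj)) i≢j
      by-cases false false s (suc (suc t)) hi hj refl et = card-D fuel _ _ _ w₁
        (subst (λ t → k + ∣ S ∣ + t ≤ fuel) et (fuel-advance Q S le ef S⊑Q))
        (still-fresh hi σi) (still-fresh hj σj)
        (∣actives-advance∣ σ p S σp S⊑Q ea) (trans (∣freshs-advance∣ σ p S σp) et)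

  module _ (r : Fin n) (Z : Subset n) (r∈ : lookup Z r ≡ true) (w₀ : Fin n → Val) where

    card-start-C : ∀ k → Safe (start r Z) → ∣ Z ∣ ≡ suc k → Card (Completion (start r Z) w₀) (C k ∣ ∁ Z ∣)
    card-start-C k safe e = card-C _ _ _ _ w₀ ℕ.≤-refl safe (∣actives-start∣ r Z r∈ e) (∣freshs-start∣ r Z r∈)

    card-start-X : ∀ i′ j′ k u → Blocked i j i′ j′ → i′ ≢ r → lookup Z i′ ≡ true → lookup Z j′ ≡ false →
                   ∣ Z ∣ ≡ 2 + k → ∣ ∁ Z ∣ ≡ suc u → Card (Completion (start r Z) w₀) (X k u)
    card-start-X i′ j′ k u b i′≢r hi hj ez eu = card-X i′ j′ _ _ _ w₀ b
      (start-∈ r Z hi i′≢r) (start-∉ r Z hj λ { refl → true≢false (trans (sym r∈) hj) })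
      (∣actives-start∣ r Z r∈ ez) (trans (∣freshs-start∣ r Z r∈) eu)

    card-start-D : ∀ k u → lookup Z i ≡ false → lookup Z j ≡ false →
                   ∣ Z ∣ ≡ suc k → ∣ ∁ Z ∣ ≡ 2 + u → Card (Completion (start r Z) w₀) (D k u)
    card-start-D k u hi hj ez eu = card-D _ _ _ _ w₀ ℕ.≤-refl
      (start-∉ r Z hi λ { refl → true≢false (trans (sym r∈) hi) })
      (start-∉ r Z hj λ { refl → true≢false (trans (sym r∈) hj) })
      (∣actives-start∣ r Z r∈ ez) (trans (∣freshs-start∣ r Z r∈) eu)

card-fibres : ∀ {a p} {A : Set a} {m} (i j : Fin (2 + m)) → i ≢ j →
  {K : Subset (2 + m) → Pred A p} (φ : Bool → Bool → ℕ → ℕ → ℕ) →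
  (∀ {S T x} → K S x → K T x → S ≡ T) →
  (∀ Z → Card (K Z) (φ (lookup Z i) (lookup Z j) ∣ Z ∣ ∣ ∁ Z ∣)) →
  Card (λ x → ∃ λ Z → K Z x) (bin m (bin₂ φ))
card-fibres {m = m} i j i≢j φ disjoint c = card-cong
  (trans (Σ⊆-cong ⊤ λ S _ → cong (λ A → φ (lookup S i) (lookup S j) ∣ S ∣ ∣ A ∣) (∁≡ S))
    (Σ⊆-bin₂ ⊤ i j i≢j (all i) (all j) (∣⊤∣≡n (2 + m)) φ))
  (card-⇔ (λ (Z , _ , k) → Z , k) (λ (Z , k) → Z , (λ v _ → all v) , k)
    (card-Σ⊆ ⊤ disjoint λ Z _ → c Z))
  where
  all : ∀ v → lookup ⊤ v ≡ true
  all v = lookup-replicate v true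
  ∁≡ : ∀ {n} (S : Subset n) → ∁ S ≡ ⊤ ─ S
  ∁≡ []          = refl
  ∁≡ (true ∷ S)  = cong (false ∷_) (∁≡ S)
  ∁≡ (false ∷ S) = cong (true ∷_) (∁≡ S)

∈∁ : ∀ {n} (Z : Subset n) {v} → lookup Z v ≡ false → lookup (∁ Z) v ≡ true
∈∁ Z {v} h = trans (lookup-∁ Z v) (cong not h)

-- Parent vectors of trees

maximum : ∀ {n} (Z : Subset n) {v} → lookup Z v ≡ true →
          ∃ λ r → lookup Z r ≡ true × (∀ u → lookup Z u ≡ true → u Fin.≤ r)
maximum (x ∷ Z) {v} h with ∣ Z ∣ in e
... | suc _ =
  let (u , hu) = ∣∣≡suc⇒nonempty Z e
      (r , hr , max) = maximum Z hu
  in suc r , hr , λ { zero _ → z≤n ; (suc u) hu → s≤s (max u hu) }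
... | zero with v
...   | suc v = contradiction h (∣∣≡0⇒∉ {A = Z} e)
...   | zero  = zero , h , λ { zero _ → z≤n ; (suc u) hu → contradiction hu (∣∣≡0⇒∉ {A = Z} e) }

module _ {n : ℕ} (i j : Fin n) where

  -- A path of parents from v through fresh vertices to an active one, never along the missing edge.
  -- Being inductive, it rules out cycles of parents.
  data Reaches (σ : State n) (w : Vec (Fin n) n) (v : Fin n) : Set where
    arrive : ¬ Blocked i j (lookup w v) v → σ (lookup w v) ≡ active → Reaches σ w v
    climb  : ¬ Blocked i j (lookup w v) v → σ (lookup w v) ≡ fresh → Reaches σ w (lookup w v) → Reaches σ w v

  Rooted : State n → Vec (Fin n) n → Set
  Rooted σ w = ∀ v → σ v ≡ fresh → Reaches σ w v

  reaches-unblocked : ∀ {σ w v} → Reaches σ w v → ¬ Blocked i j (lookup w v) v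
  reaches-unblocked (arrive b _)  = b
  reaches-unblocked (climb b _ _) = b

  parentSystem : System i j (Fin n)
  parentSystem = record
    { _≟_       = Fin._≟_
    ; mark      = λ σ p v → p
    ; Complete  = Rooted
    ; finished  = λ σ w none v h → contradiction h (none v)
    ; stuck     = λ σ w v none h rooted → stuck none (rooted v h)
    ; explore   = explore
    ; unexplore = unexplore
    ; maximal   = maximal
    }
    where
    Discovered : State n → Fin n → Vec (Fin n) n → Fin n → Set
    Discovered σ p w v = σ v ≡ fresh × ¬ Blocked i j p v × lookup w v ≡ p

    stuck : ∀ {σ w v} → (∀ u → σ u ≢ active) → ¬ Reaches σ w v
    stuck none (arrive _ a)  = none _ a
    stuck none (climb _ _ r) = stuck none r

    explore : ∀ σ w p S → σ p ≡ active → (∀ v → lookup S v ≡ true → Discovered σ p w v) →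
              (∀ v → Discovered σ p w v → lookup S v ≡ true) → Rooted σ w → Rooted (advance σ p S) w
    explore σ w p S σp S⇒ S⇐ rooted v h = go v (proj₁ h′) (proj₂ (proj₂ h′)) (rooted v (proj₂ (proj₂ h′)))
      where
      h′ = advance-fresh σ p S v h
      go : ∀ v → lookup S v ≡ false → σ v ≡ fresh → Reaches σ w v → Reaches (advance σ p S) w v
      go v v∉ f (arrive b a) with advanced σ p S (lookup w v)
      ... | discovered _ e  = arrive b e
      -- A vertex with parent p is a child of p, hence in S and no longer fresh.
      ... | processed _ e _ = contradiction (trans (sym (S⇐ v (f , subst (λ x → ¬ Blocked i j x v) e b , e))) v∉) λ ()
      ... | unchanged _ _ e = arrive b (trans e a)
      go v v∉ f (climb b f′ r) with advanced σ p S (lookup w v)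
      ... | discovered _ e    = arrive b e
      ... | processed _ e _   = contradiction (trans (sym σp) (trans (cong σ (sym e)) f′)) λ ()
      ... | unchanged v∉′ _ e = climb b (trans e f′) (go (lookup w v) v∉′ f′ r)

    unexplore : ∀ σ w p S → σ p ≡ active → (∀ v → lookup S v ≡ true → Discovered σ p w v) →
                Rooted (advance σ p S) w → Rooted σ w
    unexplore σ w p S σp S⇒ rooted v f = cases (advanced σ p S v)
      where
      from-p : ∀ v → lookup S v ≡ true → Reaches σ w v
      from-p v v∈ = let (_ , b , e) = S⇒ v v∈ in arrive (subst (λ x → ¬ Blocked i j x v) (sym e) b) (trans (cong σ e) σp)
      go : ∀ v → Reaches (advance σ p S) w v → Reaches σ w v
      go v (arrive b a) with advanced σ p S (lookup w v)
      ... | discovered v∈ _ = climb b (proj₁ (S⇒ _ v∈)) (from-p _ v∈)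
      ... | processed _ _ e = contradiction (trans (sym e) a) λ ()
      ... | unchanged _ _ e = arrive b (trans (sym e) a)
      go v (climb b f r) = climb b (proj₂ (proj₂ (advance-fresh σ p S _ f))) (go _ r)
      cases : Advanced σ p S v → Reaches σ w v
      cases (discovered v∈ _)    = from-p v v∈
      cases (processed _ refl _) = contradiction (trans (sym σp) f) λ ()
      cases (unchanged _ _ e)    = go v (rooted v (trans e f))

    maximal : ∀ σ w p S → σ p ≡ active → (∀ v → lookup S v ≡ true → Discovered σ p w v) →
              Rooted (advance σ p S) w → ∀ v → Discovered σ p w v → lookup S v ≡ true
    maximal σ w p S σp S⇒ rooted v (f , _ , e) with advanced σ p S v
    ... | discovered v∈ _    = v∈
    ... | processed _ refl _ = contradiction (trans (sym σp) f) λ ()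
    -- Otherwise v stays fresh while its parent p is done, and no path leads from v to an active
    -- vertex.
    ... | unchanged _ _ e′   = contradiction (rooted v (trans e′ f)) unreachable
      where
      p-done : advance σ p S (lookup w v) ≡ done
      p-done with advanced σ p S p
      ... | discovered p∈ _   = contradiction (trans (sym σp) (proj₁ (S⇒ p p∈))) λ ()
      ... | processed _ _ e″  = trans (cong (advance σ p S) e) e″
      ... | unchanged _ p≢p _ = contradiction refl p≢p
      unreachable : ¬ Reaches (advance σ p S) w v
      unreachable (arrive _ a)  = contradiction (trans (sym p-done) a) λ ()
      unreachable (climb _ f _) = contradiction (trans (sym p-done) f) λ ()

  -- From a fixed point the path would climb to the same vertex forever, but it is finite and must
  -- leave the fresh vertices.
  reaches-not-fixed : ∀ {σ w v} → σ v ≡ fresh → Reaches σ w v → lookup w v ≢ v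
  reaches-not-fixed {σ} f (arrive _ a) e  = contradiction (trans (sym f) (trans (cong σ (sym e)) a)) λ ()
  reaches-not-fixed {w = w} f (climb _ f′ r) e = reaches-not-fixed f′ r (cong (lookup w) e)

  -- Making the root its own parent gives every vertex an entry and lets w alone determine the root.
  ParentVector : Vec (Fin n) n → Fin n → Set
  ParentVector w r = lookup w r ≡ r × Rooted (initial r) w

  root-unique : ∀ {w r r′} → ParentVector w r → ParentVector w r′ → r ≡ r′
  root-unique {w} {r} {r′} (e , _) (_ , rooted) with r Fin.≟ r′
  ... | yes r≡r′ = r≡r′
  ... | no r≢r′  = contradiction e (reaches-not-fixed (initial-other r≢r′) (rooted r (initial-other r≢r′)))

  UprootedVector : Vec (Fin n) n → Fin n → Set
  UprootedVector w r = ParentVector w r × (∀ v → v ≢ r → lookup w v ≡ r → v Fin.< r)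

blocked-sym : ∀ {n} {i j u v : Fin n} → Blocked i j u v → Blocked i j v u
blocked-sym (inj₁ (a , b)) = inj₂ (b , a)
blocked-sym (inj₂ (a , b)) = inj₁ (b , a)

-- Counting uprooted parent vectors by the root and its children

module CountTrees {m} (i j : Fin (2 + m)) (i≢j : i ≢ j)
                  (i-min : ∀ (v : Fin (2 + m)) → i Fin.≤ v) (j-max : ∀ (v : Fin (2 + m)) → v Fin.≤ j) where
  private
    n = 2 + m
    sys = parentSystem i j
  open System sys using (explore; unexplore; maximal)
  open Counting i≢j sys

  -- Z consists of the root and its children, as w r = r for the root r.
  RootedAt : Subset n → Vec (Fin n) n → Set
  RootedAt Z w = ∃ λ r → UprootedVector i j w r ×
    (∀ v → lookup Z v ≡ true → lookup w v ≡ r) × (∀ v → lookup w v ≡ r → lookup Z v ≡ true)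

  rootedAt-unique : ∀ {S T w} → RootedAt S w → RootedAt T w → S ≡ T
  rootedAt-unique {S} {T} {w} (r , (pv , _) , S⇒ , S⇐) (r′ , (pv′ , _) , T⇒ , T⇐)
    with refl ← root-unique i j pv pv′ = ⊑-antisym (λ v v∈ → T⇐ v (S⇒ v v∈)) (λ v v∈ → S⇐ v (T⇒ v v∈))

  -- The value at `true true` is 0, as n would be the root and 1 its child. For n alone the root is
  -- n, done after the first step, so `C` applies at once. For 1 alone, `X` needs a further element
  -- of Z: a root 1 without children leaves the other vertices unreached.
  countT : Bool → Bool → ℕ → ℕ → ℕ
  countT true  false (suc (suc s)) (suc t)       = X s t
  countT false true  (suc s)       t             = C s t
  countT false false (suc s)       (suc (suc t)) = D s t
  countT _     _     _             _             = 0

  bin₂-countT : ∀ s t → bin₂ countT s t ≡ total s t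
  bin₂-countT zero    t = refl
  bin₂-countT (suc s) t = trans (cong (λ x → X s t + (x + D s t)) (sym (X+C s t)))
    (lemma (X s t) (C (2 + s) t) (D s t))
    where
    lemma : ∀ x c d → x + (x + c + d) ≡ d + (x + x + c)
    lemma = solve-∀

  module _ (Z : Subset n) where

    -- The root belongs to Z, being its own parent, and exceeds its children, so it is max Z.
    largest : ∀ {r} → lookup Z r ≡ true → (∀ u → lookup Z u ≡ true → u Fin.≤ r) →
              ∀ {w} → (k : RootedAt Z w) → proj₁ k ≡ r
    largest {r} r∈ max {w} (r′ , ((e , _) , up) , Z⇒ , Z⇐) with r Fin.≟ r′
    ... | yes r≡r′ = sym r≡r′
    ... | no r≢r′  = contradiction (up r r≢r′ (Z⇒ r r∈)) (ℕ.≤⇒≯ (max r′ (Z⇐ r′ e)))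

    module _ {r} (r∈ : lookup Z r ≡ true) (max : ∀ u → lookup Z u ≡ true → u Fin.≤ r)
             -- Keeps the first step from crossing the missing edge.
             (not-both : lookup Z i ≡ true → lookup Z j ≡ true → r ≢ i × r ≢ j) where

      private
        ¬blocked : ∀ {v} → lookup Z v ≡ true → ¬ Blocked i j r v
        ¬blocked v∈ (inj₁ (refl , refl)) = proj₁ (not-both r∈ v∈) refl
        ¬blocked v∈ (inj₂ (refl , refl)) = proj₂ (not-both v∈ r∈) refl

      to-start : ∀ {w} → RootedAt Z w → Completion (start r Z) (const r) w
      to-start {w} k@(r′ , ((e , rooted) , up) , Z⇒ , Z⇐) with refl ← largest r∈ max k =
        agree , explore (initial r) w r (delete Z r) (initial-self r) S⇒ S⇐ rooted
        where
        agree : ∀ v → start r Z v ≢ fresh → lookup w v ≡ r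
        agree v h = cases (v Fin.≟ r) (lookup Z v) refl
          where
          cases : Dec (v ≡ r) → ∀ b → lookup Z v ≡ b → lookup w v ≡ r
          cases (yes refl) _     hv = e
          cases (no v≢r)   true  hv = Z⇒ v hv
          cases (no v≢r)   false hv = contradiction (start-∉ r Z hv v≢r) h
        S⇒ : ∀ v → lookup (delete Z r) v ≡ true → _
        S⇒ v h = let (v≢r , v∈) = lookup-delete⁻ Z v r h in initial-other v≢r , ¬blocked v∈ , Z⇒ v v∈
        S⇐ : ∀ v → _ → lookup (delete Z r) v ≡ true
        S⇐ v (f , _ , e) = trans (lookup-delete′ Z (initial-fresh f)) (Z⇐ v e)

      from-start : ∀ {w} → Completion (start r Z) (const r) w → RootedAt Z w
      from-start {w} (agree , rooted) = r , ((at r r∈ , rooted′) , up) , at , Z⇐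
        where
        at : ∀ v → lookup Z v ≡ true → lookup w v ≡ r
        at v v∈ = agree v λ f → true≢false (trans (sym v∈) (start-fresh r Z r∈ f))
        S⇒ : ∀ v → lookup (delete Z r) v ≡ true → _
        S⇒ v h = let (v≢r , v∈) = lookup-delete⁻ Z v r h in initial-other v≢r , ¬blocked v∈ , at v v∈
        rooted′ : Rooted i j (initial r) w
        rooted′ = unexplore (initial r) w r (delete Z r) (initial-self r) S⇒ rooted
        Z⇐ : ∀ v → lookup w v ≡ r → lookup Z v ≡ true
        Z⇐ v e with v Fin.≟ r
        ... | yes refl = r∈
        ... | no v≢r   = trans (sym (lookup-delete′ Z v≢r))
          (maximal (initial r) w r (delete Z r) (initial-self r) S⇒ rooted v
            (initial-other v≢r , subst (λ x → ¬ Blocked i j x v) e (reaches-unblocked i j (rooted′ v (initial-other v≢r))) , e))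
        up : ∀ v → v ≢ r → lookup w v ≡ r → v Fin.< r
        up v v≢r e = Fin.≤∧≢⇒< (max v (Z⇐ v e)) v≢r

    card-rootedAt : ∀ x y s t → lookup Z i ≡ x → lookup Z j ≡ y → ∣ Z ∣ ≡ s → ∣ ∁ Z ∣ ≡ t →
                    Card (RootedAt Z) (countT x y s t)
    card-rootedAt true true s t hi hj es et = card-∅ λ {w} k@(r , ((e , rooted) , up) , Z⇒ , Z⇐) →
      let r≡j = largest hj (λ u _ → j-max u) k
          i≢r = λ i≡r → i≢j (trans i≡r r≡j)
      in reaches-unblocked i j (rooted i (initial-other i≢r)) (inj₂ (trans (Z⇒ i hi) r≡j , refl))
    card-rootedAt true false zero t hi hj es et = contradiction hi (∣∣≡0⇒∉ {A = Z} es)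
    card-rootedAt true false (suc s) zero hi hj es et = contradiction (∈∁ Z hj) (∣∣≡0⇒∉ {A = ∁ Z} et)
    -- Here Z = {1}, so nothing is active after the first step, and `C 0 (suc t)` is 0.
    card-rootedAt true false (suc zero) (suc t) hi hj es et =
      card-⇔ (from-start hi max not-both) (to-start hi max not-both)
        (card-cong (cong (C 0) et) (card-start-C i Z hi (const i) 0 safe es))
      where
      max : ∀ u → lookup Z u ≡ true → u Fin.≤ i
      max u u∈ = Fin.≤-reflexive (∣∣≡1⇒unique {A = Z} es u∈ hi)
      not-both : lookup Z i ≡ true → lookup Z j ≡ true → i ≢ i × i ≢ j
      not-both _ j∈ = contradiction (trans (sym j∈) hj) λ ()
      safe : Safe (start i Z)
      safe u v (inj₁ (refl , refl)) _ = start-self i Z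
      safe u v (inj₂ (refl , refl)) f = contradiction (trans (sym (start-self i Z)) f) λ ()
    card-rootedAt true false (suc (suc s)) (suc t) hi hj es et =
      let (r , r∈ , max) = maximum Z hi
          (u , u∈′) = ∣∣≡suc⇒nonempty (delete Z i) (ℕ.suc-injective (trans (sym (∣delete∣ Z i hi)) es))
          (u≢i , u∈) = lookup-delete⁻ Z u i u∈′
          -- Some u in Z differs from the least vertex i, so max Z is not i, and i is an active
          -- child after the first step.
          i≢r = λ i≡r → u≢i (Fin.≤-antisym (subst (u Fin.≤_) (sym i≡r) (max u u∈)) (i-min u))
          not-both = λ _ j∈ → contradiction (trans (sym j∈) hj) λ ()
      in card-⇔ (from-start r∈ max not-both) (to-start r∈ max not-both)
           (card-start-X r Z r∈ (const r) i j s t (inj₁ (refl , refl)) i≢r hi hj es et)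
    card-rootedAt false true zero t hi hj es et = contradiction hj (∣∣≡0⇒∉ {A = Z} es)
    card-rootedAt false true (suc s) t hi hj es et =
      card-⇔ (from-start hj max not-both) (to-start hj max not-both)
        (card-cong (cong (C s) et) (card-start-C j Z hj (const j) s safe es))
      where
      max : ∀ u → lookup Z u ≡ true → u Fin.≤ j
      max u _ = j-max u
      not-both : lookup Z i ≡ true → lookup Z j ≡ true → j ≢ i × j ≢ j
      not-both i∈ _ = contradiction (trans (sym i∈) hi) λ ()
      safe : Safe (start j Z)
      safe u v (inj₁ (refl , refl)) f = contradiction (trans (sym (start-self j Z)) f) λ ()
      safe u v (inj₂ (refl , refl)) _ = start-self j Z
    card-rootedAt false false zero t hi hj es et = card-∅ λ (r , ((e , _) , _) , _ , Z⇐) → ∣∣≡0⇒∉ {A = Z} es (Z⇐ r e)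
    card-rootedAt false false (suc s) zero hi hj es et = contradiction (∈∁ Z hj) (∣∣≡0⇒∉ {A = ∁ Z} et)
    card-rootedAt false false (suc s) (suc zero) hi hj es et =
      contradiction (∣∣≡1⇒unique {A = ∁ Z} et (∈∁ Z hi) (∈∁ Z hj)) i≢j
    card-rootedAt false false (suc s) (suc (suc t)) hi hj es et =
      let (v , v∈) = ∣∣≡suc⇒nonempty Z es
          (r , r∈ , max) = maximum Z v∈
          not-both = λ _ j∈ → contradiction (trans (sym j∈) hj) λ ()
      in card-⇔ (from-start r∈ max not-both) (to-start r∈ max not-both)
           (card-start-D r Z r∈ (const r) s t hi hj es et)

  card-uprootedVectors : Card (λ w → ∃ λ r → UprootedVector i j w r) (bin m total)
  card-uprootedVectors = card-cong (bin-cong m λ s t _ → bin₂-countT s t)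
    (card-⇔ (λ (_ , r , up , _) → r , up) to
      (card-fibres i j i≢j countT rootedAt-unique λ Z → card-rootedAt Z _ _ _ _ refl refl refl refl))
    where
    to : ∀ {w} → (∃ λ r → UprootedVector i j w r) → ∃ λ Z → RootedAt Z w
    to {w} (r , up) = Z , r , up ,
      select⇒ (λ v → lookup w v Fin.≟ r) , select⇐ (λ v → lookup w v Fin.≟ r)
      where Z = select λ v → lookup w v Fin.≟ r

-- Walks and simple paths

module _ {a} {A : Set a} where

  last : A → List A → A
  last x []      = x
  last x (y ∷ l) = last y l

  penultimate : A → A → List A → A
  penultimate x y []      = x
  penultimate x y (z ∷ l) = penultimate y z l

  last-∷ʳ : ∀ x l y → last x (l ∷ʳ y) ≡ y
  last-∷ʳ x []      y = refl
  last-∷ʳ x (z ∷ l) y = last-∷ʳ z l y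

  penultimate-∷ʳ : ∀ x y l z → penultimate x y (l ∷ʳ z) ∈ y ∷ l
  penultimate-∷ʳ x y []      z = here refl
  penultimate-∷ʳ x y (w ∷ l) z = there (penultimate-∷ʳ y w l z)

  linked-∷ʳ : ∀ {ℓ} {R : A → A → Set ℓ} x l {y} → Linked R (x ∷ l) → R (last x l) y → Linked R (x ∷ (l ∷ʳ y))
  linked-∷ʳ x []      _            r = r ∷ [-]
  linked-∷ʳ x (z ∷ l) (s ∷ linked) r = s ∷ linked-∷ʳ z l linked r

  NonBacktracking : List A → Set a
  NonBacktracking (x ∷ l@(_ ∷ z ∷ _)) = x ≢ z × NonBacktracking l
  NonBacktracking _                   = Lift a Unit.⊤

  nonBacktracking-∷ʳ : ∀ x y l z → Unique (x ∷ y ∷ l) → All (_≢ z) (x ∷ y ∷ l) → NonBacktracking (x ∷ y ∷ (l ∷ʳ z))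
  nonBacktracking-∷ʳ x y []      z _ (x≢z ∷ _) = x≢z , _
  nonBacktracking-∷ʳ x y (w ∷ l) z ((_ ∷ x≢w ∷ _) ∷ unique) (_ ∷ ≢z) = x≢w , nonBacktracking-∷ʳ y w l z unique ≢z

module _ {a ℓ} {A : Set a} (_≟_ : DecidableEquality A) {R : A → A → Set ℓ} where

  SimplePath : A → A → Set _
  SimplePath x y = ∃ λ l → Linked R (x ∷ l) × Unique (x ∷ l) × last x l ≡ y

  suffix : ∀ {x y z} l → x ∈ y ∷ l → Linked R (y ∷ l) → Unique (y ∷ l) → last y l ≡ z → SimplePath x z
  suffix l       (here refl) linked       unique       e = l , linked , unique , e
  suffix (_ ∷ l) (there x∈)  (_ ∷ linked) (_ ∷ unique) e = suffix l x∈ linked unique e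

  -- Loop erasure: if x occurs on the simple path already built from its successor, only the part
  -- from x onwards is kept.
  simplify : ∀ {x y} → Star R x y → SimplePath x y
  simplify ε = [] , [-] , [] ∷ [] , refl
  simplify {x} (_◅_ {j = z} r path) with simplify path
  ... | l , linked , unique , e with Any.any? (x ≟_) (z ∷ l)
  ...   | yes x∈ = suffix l x∈ linked unique e
  ...   | no x∉  = z ∷ l , r ∷ linked , ¬Any⇒All¬ _ x∉ ∷ unique , e

least : ∀ {p} {P : Pred ℕ p} → Decidable P → ∀ k → P k → ∃ λ m → P m × (∀ l → P l → m ≤ l)
least P? zero    pk = 0 , pk , λ _ _ → z≤n
least P? (suc k) pk with P? 0
... | yes p0 = 0 , p0 , λ _ _ → z≤n
... | no ¬p0 = let (m , pm , min) = least (P? ∘ suc) k pk in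
  suc m , pm , λ { zero p0 → contradiction p0 ¬p0 ; (suc l) pl → s≤s (min l pl) }

-- Rooted trees as parent vectors

Edge : ∀ {n} → Vec (Fin n) n → Fin n → Fin n → Set
Edge w u v = u ≢ v × (lookup w u ≡ v ⊎ lookup w v ≡ u)

edge? : ∀ {n} (w : Vec (Fin n) n) u v → Dec (Edge w u v)
edge? w u v = ¬? (u Fin.≟ v) ×-dec (lookup w u Fin.≟ v ⊎-dec lookup w v Fin.≟ u)

edge-sym : ∀ {n} {w : Vec (Fin n) n} {u v} → Edge w u v → Edge w v u
edge-sym (u≢v , e) = u≢v ∘ sym , Sum′.swap e

T⇒≡ : ∀ {b} → T b → b ≡ true
T⇒≡ {true} _ = refl

≡⇒T : ∀ {b} → b ≡ true → T b
≡⇒T refl = _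

module _ {n} {i j : Fin n} where

  initial-active : ∀ {r v : Fin n} → initial r v ≡ active → v ≡ r
  initial-active {r} {v} h with v Fin.≟ r
  ... | yes v≡r = v≡r

  module _ {r : Fin n} where

    reaches-no-2-cycle : ∀ {w v} → lookup w r ≡ r → v ≢ r → Reaches i j (initial r) w v → lookup w (lookup w v) ≢ v
    reaches-no-2-cycle {w} {v} wr v≢r (arrive _ a) e =
      v≢r (trans (sym e) (trans (cong (lookup w) (initial-active a)) wr))
    reaches-no-2-cycle {w} wr v≢r (climb _ f r) e = reaches-no-2-cycle wr (initial-fresh f) r (cong (lookup w) e)

    module _ {w w′} (pw : ParentVector i j w r) (pw′ : ParentVector i j w′ r)
             (w′⇒w : ∀ u v → Edge w′ u v → Edge w u v) where

      -- If w′ and w disagree at v then w′ v is a child of v for w, and the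
      -- ancestors of v for w′ are descendants of v for w: the root would be one.
      no-descent : ∀ {v} → v ≢ r → Reaches i j (initial r) w′ v → lookup w (lookup w′ v) ≢ v
      no-descent {v} v≢r (arrive _ a) e =
        v≢r (trans (sym e) (trans (cong (lookup w) (initial-active a)) (proj₁ pw)))
      no-descent {v} v≢r path@(climb _ f path′) e
        with proj₂ (w′⇒w (lookup w′ v) _ ((reaches-not-fixed i j f path′ ∘ sym) , inj₁ refl))
      ... | inj₁ e′ = reaches-no-2-cycle (proj₁ pw′) v≢r path (trans (sym e′) e)
      ... | inj₂ e′ = no-descent (initial-fresh f) path′ e′

      -- The edge from v to its parent for w′ leads, for w, either to the parent of v or to a child
      -- of v; `no-descent` excludes the child.
      parents-unique : w ≡ w′
      parents-unique = vec-ext eq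
        where
        eq : ∀ v → lookup w v ≡ lookup w′ v
        eq v with v Fin.≟ r
        ... | yes refl = trans (proj₁ pw) (sym (proj₁ pw′))
        ... | no v≢r
          with path ← proj₂ pw′ v (initial-other v≢r)
          with proj₂ (w′⇒w v _ (reaches-not-fixed i j (initial-other v≢r) path ∘ sym , inj₁ refl))
        ...   | inj₁ e = e
        ...   | inj₂ e = contradiction e (no-descent v≢r path)

module FromTree {n} (tree : RootedTree n) where
  open RootedTree tree

  adjacent-sym : ∀ {u v} → Adjacent u v → Adjacent v u
  adjacent-sym {u} {v} = subst T (symm u v)

  -- With the length as an index, existence is decidable at each length; a shortest walk, and from
  -- it a parent, can then be computed.
  Walk : ℕ → Fin n → Set
  Walk zero    v = v ≡ root
  Walk (suc k) v = ∃ λ u → Adjacent v u × Walk k u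

  walk? : ∀ v k → Dec (Walk k v)
  walk? v zero    = v Fin.≟ root
  walk? v (suc k) = Fin.any? λ u → T? (adj v u) ×-dec walk? u k

  walk : ∀ {v} → Star Adjacent v root → ∃ λ k → Walk k v
  walk ε        = 0 , refl
  walk (a ◅ as) = let (k , w) = walk as in suc k , _ , a , w

  shortest : ∀ v → ∃ λ k → Walk k v × (∀ l → Walk l v → k ≤ l)
  shortest v = let (k , w) = walk (connected v root) in least (walk? v) k w

  distance : Fin n → ℕ
  distance v = proj₁ (shortest v)

  -- The default for the empty walk makes the root its own parent.
  first-step : ∀ {v} k → Walk k v → Fin n
  first-step {v} zero    _       = v
  first-step     (suc k) (u , _) = u

  parent : Fin n → Fin n
  parent v = first-step (distance v) (proj₁ (proj₂ (shortest v)))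

  parent-root : parent root ≡ root
  parent-root with shortest root
  ... | zero  , _ , _   = refl
  ... | suc k , _ , min = contradiction (min 0 refl) λ ()

  parent-step : ∀ {v} → v ≢ root → Adjacent v (parent v) × distance (parent v) < distance v
  parent-step {v} v≢r with shortest v
  ... | zero  , e , _           = contradiction e v≢r
  ... | suc k , (u , a , w) , _ = a , s≤s (proj₂ (proj₂ (shortest u)) k w)

  TreeEdge : Fin n → Fin n → Set
  TreeEdge u v = Adjacent u v × (parent u ≡ v ⊎ parent v ≡ u)

  to-root : ∀ k v → distance v ≤ k → Star TreeEdge v root
  to-root k v le with v Fin.≟ root
  ... | yes refl = ε
  to-root zero    v le | no v≢r = contradiction (ℕ.≤-trans (proj₂ (parent-step v≢r)) le) λ ()
  to-root (suc k) v le | no v≢r = let (a , lt) = parent-step v≢r in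
    (a , inj₁ refl) ◅ to-root k (parent v) (ℕ.≤-pred (ℕ.≤-trans lt le))

  -- Otherwise the path from u to v along parents would close up to a cycle.
  adjacent⇒parent : ∀ {u v} → Adjacent u v → parent u ≡ v ⊎ parent v ≡ u
  adjacent⇒parent {u} {v} a with parent u Fin.≟ v | parent v Fin.≟ u
  ... | yes e | _     = inj₁ e
  ... | no _  | yes e = inj₂ e
  ... | no ¬e | no ¬e′
    with simplify Fin._≟_ (to-root _ u ℕ.≤-refl ◅◅ Star.reverse (λ (a , e) → adjacent-sym a , Sum′.swap e) (to-root _ v ℕ.≤-refl))
  ... | []              , _           , _      , refl = contradiction (trans (sym (irrefl u)) (T⇒≡ a)) λ ()
  ... | x ∷ []          , (_ , e) ∷ _ , _      , refl = contradiction e [ ¬e , ¬e′ ]′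
  ... | x ∷ y ∷ l       , linked      , unique , e    = contradiction
    (linked-∷ʳ u (x ∷ y ∷ l) (Linked.map proj₁ linked) (subst (λ z → Adjacent z u) (sym e) (adjacent-sym a)))
    (acyclic u x y l unique)

  parents : Vec (Fin n) n
  parents = tabulate parent

  lookup-parents : ∀ v → lookup parents v ≡ parent v
  lookup-parents = lookup∘tabulate parent

  adjacent⇒edge : ∀ {u v} → Adjacent u v → Edge parents u v
  adjacent⇒edge {u} {v} a =
    (λ { refl → contradiction (trans (sym (irrefl u)) (T⇒≡ a)) λ () }) ,
    Sum′.map (trans (lookup-parents u)) (trans (lookup-parents v)) (adjacent⇒parent a)

  edge⇒adjacent : ∀ {u v} → Edge parents u v → Adjacent u v
  edge⇒adjacent (u≢v , inj₁ e) = step u≢v e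
    where
    step : ∀ {u v} → u ≢ v → lookup parents u ≡ v → Adjacent u v
    step {u} {v} u≢v e with u Fin.≟ root
    ... | yes refl = contradiction (trans (sym parent-root) (trans (sym (lookup-parents u)) e)) u≢v
    ... | no u≢r   = subst (Adjacent u) (trans (sym (lookup-parents u)) e) (proj₁ (parent-step u≢r))
  edge⇒adjacent {u} {v} (u≢v , inj₂ e) = adjacent-sym (edge⇒adjacent {v} {u} (u≢v ∘ sym , inj₁ e))

  module _ {i j : Fin n} (unblocked : ∀ {u v} → Adjacent u v → ¬ Blocked i j u v) where

    reaches : ∀ k v → distance v ≤ k → v ≢ root → Reaches i j (initial root) parents v
    reaches zero    v le v≢r = contradiction (ℕ.≤-trans (proj₂ (parent-step v≢r)) le) λ ()
    reaches (suc k) v le v≢r = go (lookup parents v Fin.≟ root)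
      where
      a  = proj₁ (parent-step v≢r)
      lt = proj₂ (parent-step v≢r)
      b : ¬ Blocked i j (lookup parents v) v
      b = subst (λ x → ¬ Blocked i j x v) (sym (lookup-parents v)) (unblocked (adjacent-sym a))
      go : Dec (lookup parents v ≡ root) → Reaches i j (initial root) parents v
      go (yes e)  = arrive b (trans (cong (initial root) e) (initial-self root))
      go (no p≢r) = climb b (initial-other p≢r) (reaches k _
        (subst (λ x → distance x ≤ k) (sym (lookup-parents v)) (ℕ.≤-pred (ℕ.≤-trans lt le))) p≢r)

    parentVector : ParentVector i j parents root
    parentVector = trans (lookup-parents root) parent-root , λ v f → reaches _ v ℕ.≤-refl (initial-fresh f)

module FromVector {n} {i j : Fin n} (w : Vec (Fin n) n) (r : Fin n) (pw : ParentVector i j w r) where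
  private
    wr : lookup w r ≡ r
    wr = proj₁ pw

    reaches : ∀ {v} → v ≢ r → Reaches i j (initial r) w v
    reaches v≢r = proj₂ pw _ (initial-other v≢r)

  height : ∀ {v} → Reaches i j (initial r) w v → ℕ
  height (arrive _ _)     = 0
  height (climb _ _ path) = suc (height path)

  height-irrelevant : ∀ {v} (p q : Reaches i j (initial r) w v) → height p ≡ height q
  height-irrelevant (arrive _ _)  (arrive _ _)   = refl
  height-irrelevant (climb _ _ p) (climb _ _ q)  = cong suc (height-irrelevant p q)
  height-irrelevant (arrive _ a)  (climb _ f _)  = contradiction (trans (sym a) f) λ ()
  height-irrelevant (climb _ f _) (arrive _ a)   = contradiction (trans (sym a) f) λ ()

  depth : Fin n → ℕ
  depth v with v Fin.≟ r
  ... | yes _  = 0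
  ... | no v≢r = suc (height (reaches v≢r))

  depth-root : depth r ≡ 0
  depth-root with r Fin.≟ r
  ... | yes _  = refl
  ... | no r≢r = contradiction refl r≢r

  depth-other : ∀ {v} (p : Reaches i j (initial r) w v) → v ≢ r → depth v ≡ suc (height p)
  depth-other {v} p v≢r with v Fin.≟ r
  ... | yes v≡r = contradiction v≡r v≢r
  ... | no _    = cong suc (height-irrelevant _ p)

  depth-parent : ∀ {v} → v ≢ r → depth v ≡ suc (depth (lookup w v))
  depth-parent {v} v≢r = trans (depth-other (reaches v≢r) v≢r) (cong suc (below (reaches v≢r)))
    where
    below : (p : Reaches i j (initial r) w v) → height p ≡ depth (lookup w v)
    below (arrive _ a)  = sym (trans (cong depth (initial-active {i = i} {j} a)) depth-root)
    below (climb _ f p) = sym (depth-other p (initial-fresh f))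

  Up Down : Fin n → Fin n → Set
  Up u v   = u ≢ r × lookup w u ≡ v
  Down u v = Up v u

  adj : Fin n → Fin n → Bool
  adj u v = does (edge? w u v)

  adj⇒edge : ∀ {u v} → T (adj u v) → Edge w u v
  adj⇒edge {u} {v} a = does-true (edge? w u v) (T⇒≡ a)

  edge⇒adj : ∀ {u v} → Edge w u v → T (adj u v)
  edge⇒adj {u} {v} e = ≡⇒T (dec-true (edge? w u v) e)

  Adj : Fin n → Fin n → Set
  Adj u v = T (adj u v)

  up-or-down : ∀ {u v} → Adj u v → Up u v ⊎ Down u v
  up-or-down {u} {v} a with adj⇒edge {u} {v} a
  ... | u≢v , inj₁ e = inj₁ ((λ { refl → u≢v (trans (sym wr) e) }) , e)
  ... | u≢v , inj₂ e = inj₂ ((λ { refl → u≢v (trans (sym e) wr) }) , e)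

  up⇒adj : ∀ {u v} → Up u v → Adj u v
  up⇒adj {u} (u≢r , e) = edge⇒adj ((λ u≡v → reaches-not-fixed i j (initial-other u≢r) (reaches u≢r) (trans e (sym u≡v))) , inj₁ e)

  depth-up : ∀ {u v} → Up u v → depth v < depth u
  depth-up (u≢r , refl) = ℕ.≤-reflexive (sym (depth-parent u≢r))

  -- After a step down from u to v, the only way up from v is back to u, which is forbidden; so the
  -- walk goes on descending.
  down-run : ∀ u v l → Down u v → NonBacktracking (u ∷ v ∷ l) → Linked Adj (v ∷ l) →
             depth u < depth (last v l) × Down (penultimate u v l) (last v l)
  down-run u v []      down _        _            = depth-up down , down
  down-run u v (x ∷ l) down (u≢x , nb) (a ∷ linked) with up-or-down {v} {x} a
  ... | inj₁ up    = contradiction (trans (sym (proj₂ down)) (proj₂ up)) u≢x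
  ... | inj₂ down′ = let (lt , d) = down-run v x l down′ nb linked in ℕ.<-trans (depth-up down) lt , d

  -- A walk in a tree without backtracking first goes up and then down.
  walk-shape : ∀ u v l → NonBacktracking (u ∷ v ∷ l) → Linked Adj (u ∷ v ∷ l) →
               depth (last v l) < depth u ⊎ Down (penultimate u v l) (last v l)
  walk-shape u v l nb (a ∷ linked) with up-or-down {u} {v} a
  ... | inj₂ down = inj₂ (proj₂ (down-run u v l down nb linked))
  walk-shape u v []      nb       (a ∷ linked) | inj₁ up = inj₁ (depth-up up)
  walk-shape u v (x ∷ l) (_ , nb) (a ∷ linked) | inj₁ up =
    Sum′.map₁ (λ lt → ℕ.<-trans lt (depth-up up)) (walk-shape v x l nb linked)

  graph : SimpleGraph n
  graph = record
    { adj    = adj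
    ; symm   = λ u v → does-⇔ (mk⇔ (edge-sym {w = w}) (edge-sym {w = w})) (edge? w u v) (edge? w v u)
    ; irrefl = irrefl
    }
    where
    irrefl : ∀ u → adj u u ≡ false
    irrefl u with u Fin.≟ u
    ... | yes _  = refl
    ... | no u≢u = contradiction refl u≢u

  open SimpleGraph graph using (Acyclic; Connected; symm)

  -- Depth excludes closed walks that end higher than they began and those that start downwards, as
  -- these only descend. A closed walk that leaves u upwards and returns downwards has the parent of
  -- u as both its second and its penultimate vertex, which are distinct on a cycle.
  acyclic : Acyclic
  acyclic u v x l unique@(((u≢v ∷ u≢x ∷ u≢l) ∷ unique′@((v≢x ∷ v≢l) ∷ _))) linked@(a ∷ linked′)
    with up-or-down {u} {v} a | walk-shape u v (x ∷ (l ∷ʳ u)) nb linked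
    where
    nb : NonBacktracking (u ∷ v ∷ x ∷ (l ∷ʳ u))
    nb = u≢x , nonBacktracking-∷ʳ v x l u unique′ (All.map (_∘ sym) (u≢v ∷ u≢x ∷ u≢l))
  ... | _         | inj₁ lt   = ℕ.<-irrefl (cong depth (last-∷ʳ x l u)) lt
  ... | inj₁ up   | inj₂ down = All.lookup (v≢x ∷ v≢l) (penultimate-∷ʳ v x l u)
    (trans (sym (proj₂ up)) (trans (cong (lookup w) (sym (last-∷ʳ x l u))) (proj₂ down)))
  ... | inj₂ down | inj₂ _    = ℕ.<-irrefl (cong depth (sym (last-∷ʳ x l u)))
    (proj₁ (down-run u v (x ∷ (l ∷ʳ u)) down
      (u≢x , nonBacktracking-∷ʳ v x l u unique′ (All.map (_∘ sym) (u≢v ∷ u≢x ∷ u≢l))) linked′))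

  connected : Connected
  connected u v = to-root u ◅◅ Star.reverse (λ {x} {y} → subst T (symm x y)) (to-root v)
    where
    climb-to-root : ∀ {v} → v ≢ r → Reaches i j (initial r) w v → Star Adj v r
    climb-to-root {v} v≢r (arrive _ a)  =
      up⇒adj {v} (v≢r , initial-active {i = i} {j} a) ◅ ε
    climb-to-root {v} v≢r (climb _ f p) = up⇒adj {v} (v≢r , refl) ◅ climb-to-root (initial-fresh f) p
    to-root : ∀ v → Star Adj v r
    to-root v with v Fin.≟ r
    ... | yes refl = ε
    ... | no v≢r   = climb-to-root v≢r (reaches v≢r)

  tree : RootedTree n
  tree = record { graph = graph ; root = r ; connected = connected ; acyclic = acyclic }

-- Uprooted trees with 1 and n not adjacent correspond to uprooted vectors

module _ (m : ℕ) where
  private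
    n = 2 + m
    i j : Fin n
    i = zero
    j = fromℕ (suc m)

    unblocked : ∀ (tree : RootedTree n) → 1≁n tree → ∀ {u v} → RootedTree.Adjacent tree u v → ¬ Blocked i j u v
    unblocked tree 1≁n a (inj₁ (refl , refl)) = 1≁n _ _ refl (cong suc (Fin.toℕ-fromℕ (suc m))) a
    unblocked tree 1≁n a (inj₂ (refl , refl)) =
      1≁n _ _ refl (cong suc (Fin.toℕ-fromℕ (suc m))) (FromTree.adjacent-sym tree a)

  -- Root and edges determine the parent vector by `parents-unique`, which gives congruence of `to`
  -- and the composite on vectors; the composite on trees only compares edges.
  trees↔vectors : Inverse (𝒰′ n) (subsetoid (setoid (Vec (Fin n) n)) λ w → ∃ λ r → UprootedVector i j w r)
  trees↔vectors = record
    { to        = to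
    ; from      = from
    ; to-cong   = λ {x} {y} → to-cong x y
    ; from-cong = λ {x} {y} → from-cong x y
    ; inverse   = (λ {y} {x} eq → trans (to-cong x (from y) eq) (to-from y))
                , λ {x} {y} eq → let (p , q) = from-cong y (to x) eq ; (p′ , q′) = from-to x in
                    trans p p′ , λ u v → trans (q u v) (q′ u v)
    }
    where
    open RootedTree using (root; adj)
    𝒱 = Σ (Vec (Fin n) n) λ w → ∃ λ r → UprootedVector i j w r
    𝒯 = Σ (RootedTree n) λ tree → Uprooted tree × 1≁n tree

    to : 𝒯 → 𝒱
    to (tree , up , 1≁n) = parents , root tree , parentVector (λ {u} {v} → unblocked tree 1≁n {u} {v}) , λ v v≢r e →
      ℕ.≤-pred (up v (edge⇒adjacent {root tree} {v} (v≢r ∘ sym , inj₂ e)))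
      where open FromTree tree

    from : 𝒱 → 𝒯
    from (w , r , pw , up) = tree , (λ v a → s≤s (below v a)) , 1≁n′
      where
      open FromVector w r pw using (tree; adj⇒edge; up-or-down)
      below : ∀ v → RootedTree.Adjacent tree r v → v Fin.< r
      below v a with up-or-down {r} {v} a
      ... | inj₁ (r≢r , _) = contradiction refl r≢r
      ... | inj₂ (v≢r , e) = up v v≢r e
      1≁n′ : 1≁n tree
      1≁n′ (suc u) v () hv a
      1≁n′ zero v hu hv a with refl ← Fin.toℕ-injective {i = v} {j} (trans (ℕ.suc-injective hv) (sym (Fin.toℕ-fromℕ (suc m))))
        with up-or-down {i} {j} a
      ... | inj₁ (i≢r , e) = reaches-unblocked i j (proj₂ pw i (initial-other i≢r)) (inj₂ (e , refl))
      ... | inj₂ (j≢r , e) = reaches-unblocked i j (proj₂ pw j (initial-other j≢r)) (inj₁ (e , refl))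

    to-cong : ∀ x y → root (proj₁ x) ≡ root (proj₁ y) × (∀ u v → adj (proj₁ x) u v ≡ adj (proj₁ y) u v) →
              proj₁ (to x) ≡ proj₁ (to y)
    to-cong x y (r≡ , adj≡) = parents-unique
      (proj₁ (proj₂ (proj₂ (to x))))
      (subst (ParentVector i j _) (sym r≡) (proj₁ (proj₂ (proj₂ (to y)))))
      λ u v e → FromTree.adjacent⇒edge (proj₁ x)
        (subst T (sym (adj≡ u v)) (FromTree.edge⇒adjacent (proj₁ y) e))

    from-cong : ∀ x y → proj₁ x ≡ proj₁ y → root (proj₁ (from x)) ≡ root (proj₁ (from y)) ×
                (∀ u v → adj (proj₁ (from x)) u v ≡ adj (proj₁ (from y)) u v)
    from-cong (w , r , pw , _) (w , r′ , pw′ , _) refl = root-unique i j pw pw′ , λ u v → refl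

    to-from : ∀ y → proj₁ (to (from y)) ≡ proj₁ y
    to-from y@(w , r , pw , up) = sym (parents-unique pw (proj₁ (proj₂ (proj₂ (to (from y)))))
      λ u v e → FromVector.adj⇒edge w r pw (FromTree.edge⇒adjacent (proj₁ (from y)) e))

    from-to : ∀ x → root (proj₁ (from (to x))) ≡ root (proj₁ x) ×
              (∀ u v → adj (proj₁ (from (to x))) u v ≡ adj (proj₁ x) u v)
    from-to x@(tree , _) = refl , λ u v → does-⇔
      (mk⇔ (FromTree.edge⇒adjacent tree {u} {v}) (FromTree.adjacent⇒edge tree {u} {v}))
      (edge? (FromTree.parents tree) u v) (T? (adj tree u v))

  card-𝒰′ : HasCardinality (𝒰′ n) (bin m total)
  card-𝒰′ = card-via trees↔vectors (CountTrees.card-uprootedVectors i j (λ ()) (λ _ → z≤n)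
    λ v → subst (toℕ v ≤_) (sym (Fin.toℕ-fromℕ (suc m))) (ℕ.≤-pred (Fin.toℕ<n v)))

-- Spherical parking functions

sum-mono : ∀ {n} {f g : Fin n → ℕ} → (∀ v → f v ≤ g v) → sum f ≤ sum g
sum-mono {zero}  h = z≤n
sum-mono {suc n} h = ℕ.+-mono-≤ (h zero) (sum-mono (h ∘ suc))

sum-zero : ∀ {n} {f : Fin n → ℕ} → (∀ v → f v ≡ 0) → sum f ≡ 0
sum-zero {zero}  h = refl
sum-zero {suc n} h = cong₂ _+_ (h zero) (sum-zero (h ∘ suc))

sum-cong : ∀ {n} {f g : Fin n → ℕ} → (∀ v → f v ≡ g v) → sum f ≡ sum g
sum-cong {zero}  h = refl
sum-cong {suc n} h = cong₂ _+_ (h zero) (sum-cong (h ∘ suc))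

sum-insert : ∀ {n} {f g : Fin n → ℕ} p → f p ≡ 0 → (∀ v → v ≢ p → f v ≡ g v) → sum g ≡ g p + sum f
sum-insert {f = f} {g} zero    fp h = cong (g zero +_)
  (trans (sum-cong λ v → sym (h (suc v) λ ())) (cong (_+ sum (f ∘ suc)) (sym fp)))
sum-insert {f = f} {g} (suc p) fp h = trans
  (cong₂ _+_ (sym (h zero λ ())) (sum-insert p fp λ v v≢p → h (suc v) (v≢p ∘ Fin.suc-injective)))
  (swap (f zero) (g (suc p)) (sum (f ∘ suc)))
  where
  swap : ∀ x y z → x + (y + z) ≡ y + (x + z)
  swap = solve-∀

sum-≥ : ∀ {n} (f : Fin n → ℕ) p → f p ≤ sum f
sum-≥ f zero    = ℕ.m≤m+n _ _
sum-≥ f (suc p) = ℕ.≤-trans (sum-≥ (f ∘ suc) p) (ℕ.m≤n+m _ _)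

∣delete∣-∉ : ∀ {n} (A : Subset n) v → lookup A v ≡ false → ∣ A ∣ ≡ ∣ delete A v ∣
∣delete∣-∉ (false ∷ A) zero    h = refl
∣delete∣-∉ (true ∷ A)  (suc v) h = cong suc (∣delete∣-∉ A v h)
∣delete∣-∉ (false ∷ A) (suc v) h = ∣delete∣-∉ A v h

module _ {n : ℕ} {i j : Fin n} (i≢j : i ≢ j) (E : Fin n → Fin n → ℕ)
         (E-blocked : ∀ {u v} → Blocked i j u v → E u v ≡ 0)
         (E-adjacent : ∀ {u v} → u ≢ v → ¬ Blocked i j u v → E u v ≡ 1) where

  -- The number of edges from a into X and the root 0.
  degree : Subset n → Fin n → ℕ
  degree X a = suc (sum λ v → if lookup X v then E a v else 0)

  degree-mono : ∀ X Y a → X ⊑ Y → degree X a ≤ degree Y a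
  degree-mono X Y a X⊑Y = s≤s (sum-mono λ v → le v (lookup X v) (lookup Y v) (X⊑Y v))
    where
    le : ∀ v x y → (x ≡ true → y ≡ true) → (if x then E a v else 0) ≤ (if y then E a v else 0)
    le v false y     h = z≤n
    le v true  true  h = ℕ.≤-refl
    le v true  false h = contradiction (h refl) λ ()

  degree-empty : ∀ X a → (∀ v → lookup X v ≡ false) → degree X a ≡ 1
  degree-empty X a h = cong suc (sum-zero λ v → cong (λ b → if b then E a v else 0) (h v))

  degree-insert : ∀ X Y a p → lookup X p ≡ false → lookup Y p ≡ true → (∀ v → v ≢ p → lookup X v ≡ lookup Y v) →
                  degree Y a ≡ E a p + degree X a
  degree-insert X Y a p hX hY same = trans
    (cong suc (trans (sum-insert {f = λ v → if lookup X v then E a v else 0} p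
        (cong (λ b → if b then E a p else 0) hX)
        (λ v v≢p → cong (λ b → if b then E a v else 0) (same v v≢p)))
      (cong (_+ _) (cong (λ b → if b then E a p else 0) hY))))
    (sym (ℕ.+-suc _ _))

  degree-≥2 : ∀ X a b → lookup X b ≡ true → E a b ≡ 1 → 2 ≤ degree X a
  degree-≥2 X a b h e = s≤s (ℕ.≤-trans (ℕ.≤-reflexive (sym (trans (cong (λ x → if x then E a b else 0) h) e)))
    (sum-≥ (λ v → if lookup X v then E a v else 0) b))

  dones : State n → Subset n
  dones σ = tabulate (isDone ∘ σ)

  dones-lookup : ∀ σ v → lookup (dones σ) v ≡ isDone (σ v)
  dones-lookup σ v = lookup∘tabulate (isDone ∘ σ) v

  -- The invariant of the burning algorithm. The first half says that no fresh vertex should have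
  -- been discovered earlier; the second is the parking condition on sets of fresh vertices, so that
  -- the fire never stops.
  Burns : State n → Vec ℕ n → Set
  Burns σ w = (∀ v → σ v ≡ fresh → degree (dones σ) v ≤ lookup w v)
            × (∀ A → A ⊑ freshs σ → (∃ λ a → lookup A a ≡ true) →
                 ∃ λ a → lookup A a ≡ true × lookup w a < degree (∁ A) a)

  degree-advance : ∀ σ p S → σ p ≡ active → S ⊑ freshs σ →
                   ∀ a → degree (dones (advance σ p S)) a ≡ E a p + degree (dones σ) a
  degree-advance σ p S σp S⊑ a = degree-insert (dones σ) (dones (advance σ p S)) a p
    (trans (dones-lookup σ p) (cong isDone σp))
    (trans (dones-lookup _ p) p-done)
    λ v v≢p → trans (dones-lookup σ v) (trans (same v v≢p) (sym (dones-lookup _ v)))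
    where
    p-done : isDone (advance σ p S p) ≡ true
    p-done with advanced σ p S p
    ... | discovered p∈ _   = contradiction (trans (sym σp) (freshs⇒ σ p (S⊑ p p∈))) λ ()
    ... | processed _ _ e   = cong isDone e
    ... | unchanged _ p≢p _ = contradiction refl p≢p
    same : ∀ v → v ≢ p → isDone (σ v) ≡ isDone (advance σ p S v)
    same v v≢p with advanced σ p S v
    ... | discovered v∈ e   = trans (cong isDone (freshs⇒ σ v (S⊑ v v∈))) (sym (cong isDone e))
    ... | processed _ v≡p _ = contradiction v≡p v≢p
    ... | unchanged _ _ e   = sym (cong isDone e)

  burningSystem : System i j ℕ
  burningSystem = record
    { _≟_       = ℕ._≟_
    ; mark      = λ σ p v → degree (dones σ) v
    ; Complete  = Burns
    ; finished  = λ σ w none → (λ v f → contradiction f (none v)) ,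
                  λ A A⊑ (a , a∈) → contradiction (freshs⇒ σ a (A⊑ a a∈)) (none a)
    ; stuck     = stuck
    ; explore   = explore
    ; unexplore = unexplore
    ; maximal   = maximal
    }
    where
    Discovered : State n → Fin n → Vec ℕ n → Fin n → Set
    Discovered σ p w v = σ v ≡ fresh × ¬ Blocked i j p v × lookup w v ≡ degree (dones σ) v

    -- With nothing active, the complement of the fresh set is the done set; the two halves of
    -- `Burns`, applied to the set of all fresh vertices, contradict each other.
    stuck : ∀ σ w v → (∀ u → σ u ≢ active) → σ v ≡ fresh → ¬ Burns σ w
    stuck σ w v none f (lower , upper) =
      let (a , a∈ , lt) = upper (freshs σ) (λ _ → id) (v , freshs⇐ σ v f)
      in ℕ.<⇒≱ lt (ℕ.≤-trans (degree-mono (∁ (freshs σ)) (dones σ) a rest-done) (lower a (freshs⇒ σ a a∈)))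
      where
      rest-done : ∁ (freshs σ) ⊑ dones σ
      rest-done u h = trans (dones-lookup σ u) (cases (σ u) refl)
        where
        cases : ∀ s → σ u ≡ s → isDone (σ u) ≡ true
        cases done   e = cong isDone e
        cases active e = contradiction e (none u)
        cases fresh  e = contradiction
          (trans (sym (trans (sym (lookup-∁ (freshs σ) u)) h)) (cong not (freshs⇐ σ u e))) λ ()

    module _ (σ : State n) (w : Vec ℕ n) (p : Fin n) (S : Subset n) (σp : σ p ≡ active)
             (S⇒ : ∀ v → lookup S v ≡ true → Discovered σ p w v) where

      S⊑freshs : S ⊑ freshs σ
      S⊑freshs v v∈ = freshs⇐ σ v (proj₁ (S⇒ v v∈))

      degree′ : ∀ a → degree (dones (advance σ p S)) a ≡ E a p + degree (dones σ) a
      degree′ = degree-advance σ p S σp S⊑freshs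

      neighbour : ∀ {v} → σ v ≡ fresh → ¬ Blocked i j p v → E v p ≡ 1
      neighbour f ¬b = E-adjacent (λ { refl → contradiction (trans (sym σp) f) λ () }) (¬b ∘ blocked-sym)

      explore : (∀ v → Discovered σ p w v → lookup S v ≡ true) → Burns σ w → Burns (advance σ p S) w
      explore S⇐ (lower , upper) = lower′ ,
        λ A A⊑ → upper A λ v v∈ → freshs⇐ σ v (proj₂ (proj₂ (advance-fresh σ p S v (freshs⇒ _ v (A⊑ v v∈)))))
        where
        lower′ : ∀ v → advance σ p S v ≡ fresh → degree (dones (advance σ p S)) v ≤ lookup w v
        lower′ v h with advance-fresh σ p S v h | blocked? i j p v
        ... | _ , _ , f     | yes b = ℕ.≤-trans
          (ℕ.≤-reflexive (trans (degree′ v) (cong (_+ degree (dones σ) v) (E-blocked (blocked-sym b))))) (lower v f)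
        -- Not being in S, v has a value strictly above its old mark, which leaves room for its new
        -- done neighbour p.
        ... | v∉ , v≢p , f | no ¬b = ℕ.≤-trans
          (ℕ.≤-reflexive (trans (degree′ v) (cong (_+ degree (dones σ) v) (neighbour f ¬b))))
          (ℕ.≤∧≢⇒< (lower v f) λ e → contradiction (trans (sym (S⇐ v (f , ¬b , sym e))) v∉) λ ())

      unexplore : Burns (advance σ p S) w → Burns σ w
      unexplore (lower′ , upper′) = lower , upper
        where
        lower : ∀ v → σ v ≡ fresh → degree (dones σ) v ≤ lookup w v
        lower v f with advanced σ p S v
        ... | discovered v∈ _    = ℕ.≤-reflexive (sym (proj₂ (proj₂ (S⇒ v v∈))))
        ... | processed _ refl _ = contradiction (trans (sym σp) f) λ ()
        ... | unchanged _ _ e    = ℕ.≤-trans (ℕ.≤-trans (ℕ.m≤n+m _ (E v p)) (ℕ.≤-reflexive (sym (degree′ v))))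
                                             (lower′ v (trans e f))

        upper : ∀ A → A ⊑ freshs σ → (∃ λ a → lookup A a ≡ true) → ∃ λ a → lookup A a ≡ true × lookup w a < degree (∁ A) a
        upper A A⊑ nonempty with Fin.any? (λ a → lookup A a Bool.≟ true ×-dec lookup S a Bool.≟ true)
        -- A vertex of A discovered by p has its old mark as value, and the edge to p, which lies
        -- outside A, raises its degree above that.
        ... | yes (a , a∈A , a∈S) = a , a∈A , (begin-strict
          lookup w a                          ≡⟨ proj₂ (proj₂ (S⇒ a a∈S)) ⟩
          degree (dones σ) a                  <⟨ ℕ.n<1+n _ ⟩
          1 + degree (dones σ) a              ≡⟨ cong (_+ degree (dones σ) a) (neighbour (proj₁ (S⇒ a a∈S)) (proj₁ (proj₂ (S⇒ a a∈S)))) ⟨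
          E a p + degree (dones σ) a          ≡⟨ degree′ a ⟨
          degree (dones (advance σ p S)) a    ≤⟨ degree-mono (dones (advance σ p S)) (∁ A) a outside-A ⟩
          degree (∁ A) a                      ∎)
          where
          open ℕ.≤-Reasoning
          outside-A : dones (advance σ p S) ⊑ ∁ A
          outside-A v h = trans (lookup-∁ A v) (cong not (not-in (lookup A v) refl))
            where
            not-done : σ v ≡ fresh → advance σ p S v ≢ done
            not-done f d with advanced σ p S v
            ... | discovered _ e     = contradiction (trans (sym e) d) λ ()
            ... | processed _ refl _ = contradiction (trans (sym σp) f) λ ()
            ... | unchanged _ _ e    = contradiction (trans (sym f) (trans (sym e) d)) λ ()
            not-in : ∀ b → lookup A v ≡ b → lookup A v ≡ false
            not-in false e = e
            not-in true  e = contradiction (isDone⇒ (trans (sym (dones-lookup _ v)) h)) (not-done (freshs⇒ σ v (A⊑ v e)))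
        ... | no none = upper′ A A⊑′ nonempty
          where
          A⊑′ : A ⊑ freshs (advance σ p S)
          A⊑′ v v∈A with advanced σ p S v
          ... | discovered v∈S _   = contradiction (v , v∈A , v∈S) none
          ... | processed _ refl _ = contradiction (trans (sym σp) (freshs⇒ σ v (A⊑ v v∈A))) λ ()
          ... | unchanged _ _ e    = freshs⇐ _ v (trans e (freshs⇒ σ v (A⊑ v v∈A)))

      -- Once p is done, a child of p left fresh would have a mark exceeding its value, against the
      -- lower bound.
      maximal : Burns (advance σ p S) w → ∀ v → Discovered σ p w v → lookup S v ≡ true
      maximal (lower′ , _) v (f , ¬b , e) with advanced σ p S v
      ... | discovered v∈ _    = v∈
      ... | processed _ refl _ = contradiction (trans (sym σp) f) λ ()
      ... | unchanged _ _ e′   = contradiction (lower′ v (trans e′ f)) (ℕ.<⇒≱ (ℕ.≤-reflexive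
        (trans (cong suc e) (sym (trans (degree′ v) (cong (_+ degree (dones σ) v) (neighbour f ¬b)))))))

  -- Membership in the two ideals in terms of divisibility: the generator of the full set has all
  -- exponents 1, hence positivity, and no generator of a proper nonempty set may divide.
  Spherical : Vec ℕ n → Set
  Spherical w = (∀ v → 1 ≤ lookup w v)
              × (∀ A → (∃ λ a → lookup A a ≡ true) → (∃ λ b → lookup A b ≡ false) →
                   ∃ λ a → lookup A a ≡ true × lookup w a < degree (∁ A) a)

  open System burningSystem using (explore; unexplore; maximal)
  open Counting i≢j burningSystem

  OnesAt : Subset n → Vec ℕ n → Set
  OnesAt Z w = Spherical w × (∀ v → lookup Z v ≡ true → lookup w v ≡ 1) × (∀ v → lookup w v ≡ 1 → lookup Z v ≡ true)

  onesAt-unique : ∀ S T w → OnesAt S w → OnesAt T w → S ≡ T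
  onesAt-unique S T w (_ , S⇒ , S⇐) (_ , T⇒ , T⇐) =
    ⊑-antisym (λ v v∈ → T⇐ v (S⇒ v v∈)) (λ v v∈ → S⇐ v (T⇒ v v∈))

  -- As i and j are not adjacent, the set [n] − {i} contains a vertex a with
  -- p a = 1 that is adjacent to i.
  ordinary-one : ∀ w → Spherical w → ∃ λ r → lookup w r ≡ 1 × r ≢ i × r ≢ j
  ordinary-one w (positive , condition) = a , ℕ.≤-antisym w≤1 (positive a) , a≢i , a≢j
    where
    I A : Subset n
    I = select (λ v → v Fin.≟ i)
    A = ∁ I
    i∈I : lookup I i ≡ true
    i∈I = select⇐ (λ v → v Fin.≟ i) i refl
    ∉I : ∀ v → v ≢ i → lookup I v ≡ false
    ∉I v v≢i with lookup I v in e
    ... | false = refl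
    ... | true  = contradiction (select⇒ (λ v → v Fin.≟ i) v e) v≢i
    found = condition A (j , ∈∁ I (∉I j (i≢j ∘ sym))) (i , trans (lookup-∁ I i) (cong not i∈I))
    a = proj₁ found
    a≢i : a ≢ i
    a≢i e = contradiction (trans (sym (proj₁ (proj₂ found))) (trans (lookup-∁ I a) (cong not (trans (cong (lookup I) e) i∈I)))) λ ()
    none : Subset n
    none = delete I i
    none-empty : ∀ v → lookup none v ≡ false
    none-empty v with v Fin.≟ i
    ... | yes refl = lookup-delete I v
    ... | no v≢i   = trans (lookup-delete′ I v≢i) (∉I v v≢i)
    degree-A : degree (∁ A) a ≡ E a i + 1
    degree-A = trans (degree-insert none (∁ A) a i (none-empty i) (trans (lookup-∁∁ i) i∈I)
                 (λ v v≢i → trans (lookup-delete′ I v≢i) (sym (lookup-∁∁ v))))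
               (cong (E a i +_) (degree-empty none a none-empty))
      where
      lookup-∁∁ : ∀ v → lookup (∁ A) v ≡ lookup I v
      lookup-∁∁ v = trans (lookup-∁ A v) (trans (cong not (lookup-∁ I v)) (Bool.not-involutive _))
    w< : lookup w a < E a i + 1
    w< = subst (lookup w a <_) degree-A (proj₂ (proj₂ found))
    a≢j : a ≢ j
    a≢j e = ℕ.<⇒≱ (ℕ.≤-trans (s≤s (positive a)) w<) (ℕ.≤-reflexive (cong (_+ 1) (E-blocked (inj₂ (e , refl)))))
    w≤1 : lookup w a ≤ 1
    w≤1 = ℕ.≤-pred (subst (lookup w a <_) (cong (_+ 1) (E-adjacent a≢i
      λ { (inj₁ (e , _)) → a≢i e ; (inj₂ (e , _)) → a≢j e })) w<)

  module _ (Z : Subset n) {r} (r∈ : lookup Z r ≡ true) (r≢i : r ≢ i) (r≢j : r ≢ j) where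

    private
      ¬blocked : ∀ {v} → ¬ Blocked i j r v
      ¬blocked (inj₁ (e , _)) = r≢i e
      ¬blocked (inj₂ (e , _)) = r≢j e

      -- The edge to the root 0 alone makes every first mark 1, so the vertices discovered by r are
      -- the other vertices of value 1.
      degree-initial : ∀ v → degree (dones (initial r)) v ≡ 1
      degree-initial v = degree-empty (dones (initial r)) v λ u → trans (dones-lookup (initial r) u) (not-done u (u Fin.≟ r))
        where
        not-done : ∀ u → Dec (u ≡ r) → isDone (initial r u) ≡ false
        not-done u (yes refl) = cong isDone (initial-self r)
        not-done u (no u≢r)   = cong isDone (initial-other u≢r)

      children-of-r : ∀ w → (∀ v → lookup Z v ≡ true → lookup w v ≡ 1) → ∀ v → lookup (delete Z r) v ≡ true →
                      initial r v ≡ fresh × ¬ Blocked i j r v × lookup w v ≡ degree (dones (initial r)) v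
      children-of-r w Z⇒ v h = let (v≢r , v∈) = lookup-delete⁻ Z v r h in
        initial-other v≢r , ¬blocked , trans (Z⇒ v v∈) (sym (degree-initial v))

    ones-to-start : ∀ w → OnesAt Z w → Completion (start r Z) (const 1) w
    ones-to-start w ((positive , condition) , Z⇒ , Z⇐) = agree ,
      explore (initial r) w r (delete Z r) (initial-self r) (children-of-r w Z⇒)
        (λ v (f , _ , e) → trans (lookup-delete′ Z (initial-fresh {r = r} {v} f)) (Z⇐ v (trans e (degree-initial v))))
        ((λ v _ → subst (_≤ lookup w v) (sym (degree-initial v)) (positive v)) ,
         λ A A⊑ nonempty → condition A nonempty (r , r∉ A A⊑ (lookup A r) refl))
      where
      r∉ : ∀ A → A ⊑ freshs (initial r) → ∀ b → lookup A r ≡ b → lookup A r ≡ false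
      r∉ A A⊑ false e = e
      r∉ A A⊑ true  e = contradiction refl (initial-fresh {r = r} {r} (freshs⇒ (initial r) r (A⊑ r e)))
      agree : ∀ v → start r Z v ≢ fresh → lookup w v ≡ 1
      agree v h = cases (v Fin.≟ r) (lookup Z v) refl
        where
        cases : Dec (v ≡ r) → ∀ b → lookup Z v ≡ b → lookup w v ≡ 1
        cases (yes refl) _     hv = Z⇒ v r∈
        cases (no v≢r)   true  hv = Z⇒ v hv
        cases (no v≢r)   false hv = contradiction (start-∉ r Z hv v≢r) h

    ones-from-start : ∀ w → Completion (start r Z) (const 1) w → OnesAt Z w
    ones-from-start w (agree , burns) = (positive , condition) , Z⇒ , Z⇐
      where
      Z⇒ : ∀ v → lookup Z v ≡ true → lookup w v ≡ 1
      Z⇒ v v∈ = agree v λ f → true≢false (trans (sym v∈) (start-fresh r Z r∈ f))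
      burns′ : Burns (initial r) w
      burns′ = unexplore (initial r) w r (delete Z r) (initial-self r) (children-of-r w Z⇒) burns
      Z⇐ : ∀ v → lookup w v ≡ 1 → lookup Z v ≡ true
      Z⇐ v e with v Fin.≟ r
      ... | yes refl = r∈
      ... | no v≢r   = trans (sym (lookup-delete′ Z v≢r))
        (maximal (initial r) w r (delete Z r) (initial-self r) (children-of-r w Z⇒) burns v
          (initial-other v≢r , ¬blocked , trans e (sym (degree-initial v))))
      positive : ∀ v → 1 ≤ lookup w v
      positive v with v Fin.≟ r
      ... | yes refl = ℕ.≤-reflexive (sym (Z⇒ v r∈))
      ... | no v≢r   = subst (_≤ lookup w v) (degree-initial v) (proj₁ burns′ v (initial-other v≢r))
      condition : ∀ A → (∃ λ a → lookup A a ≡ true) → (∃ λ b → lookup A b ≡ false) →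
                  ∃ λ a → lookup A a ≡ true × lookup w a < degree (∁ A) a
      condition A nonempty (b , b∉) with lookup A r in hr
      -- The starting vertex itself witnesses the condition: r is adjacent to every other vertex, in
      -- particular to b outside A, so its degree is at least 2 while its value is 1.
      ... | true  = r , hr , subst (_< degree (∁ A) r) (sym (Z⇒ r r∈)) (degree-≥2 (∁ A) r b (∈∁ A b∉)
        (E-adjacent (λ { refl → true≢false (trans (sym hr) b∉) }) ¬blocked))
      ... | false = proj₂ burns′ A A⊑ nonempty
        where
        A⊑ : A ⊑ freshs (initial r)
        A⊑ v v∈ = freshs⇐ (initial r) v (initial-other {r = r} {v} λ { refl → true≢false (trans (sym v∈) hr) })

  -- Each nonzero clause spends an element of Z other than i and j as the starting vertex. Sizes
  -- that leave no such element count 0 by `ordinary-one`.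
  countS : Bool → Bool → ℕ → ℕ → ℕ
  countS true  true  (suc (suc (suc s))) t             = C (2 + s) t
  countS true  false (suc (suc s))       (suc t)       = X s t
  countS false true  (suc (suc s))       (suc t)       = X s t
  countS false false (suc s)             (suc (suc t)) = D s t
  countS _     _     _                   _             = 0

  bin₂-countS : ∀ s t → bin₂ countS s t ≡ total s t
  bin₂-countS zero    t = refl
  bin₂-countS (suc s) t = lemma (X s t) (C (2 + s) t) (D s t)
    where
    lemma : ∀ x c d → c + x + (x + d) ≡ d + (x + x + c)
    lemma = solve-∀

  module _ (Z : Subset n) where

    ordinary : Subset n
    ordinary = delete (delete Z i) j

    ordinary⇒ : ∀ v → lookup ordinary v ≡ true → lookup Z v ≡ true × v ≢ i × v ≢ j
    ordinary⇒ v h =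
      let (v≢j , h′) = lookup-delete⁻ (delete Z i) v j h
          (v≢i , v∈) = lookup-delete⁻ Z v i h′
      in v∈ , v≢i , v≢j

    no-ordinary : ∣ ordinary ∣ ≡ 0 → Card (OnesAt Z) 0
    no-ordinary e = card-∅ λ {w} (spherical , _ , Z⇐) →
      let (r , one , r≢i , r≢j) = ordinary-one w spherical
      in ∣∣≡0⇒∉ {A = ordinary} {r} e
           (trans (lookup-delete′ (delete Z i) r≢j) (trans (lookup-delete′ Z r≢i) (Z⇐ r one)))

    with-ordinary : ∀ {s N} → ∣ ordinary ∣ ≡ suc s →
      (∀ r → lookup Z r ≡ true → r ≢ i → r ≢ j → Card (Completion (start r Z) (const 1)) N) → Card (OnesAt Z) N
    with-ordinary e c =
      let (r , h) = ∣∣≡suc⇒nonempty ordinary e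
          (r∈ , r≢i , r≢j) = ordinary⇒ r h
      in card-⇔ (λ {w} → ones-from-start Z r∈ r≢i r≢j w) (λ {w} → ones-to-start Z r∈ r≢i r≢j w) (c r r∈ r≢i r≢j)

    size : ∀ {x y s} → lookup Z i ≡ x → lookup Z j ≡ y → ∣ Z ∣ ≡ s →
           (if x then suc else id) ((if y then suc else id) ∣ ordinary ∣) ≡ s
    size {x} {y} hi hj refl = trans (cong (if x then suc else id) (sym (remove (delete Z i) j y (trans (lookup-delete′ Z (i≢j ∘ sym)) hj))))
                                    (sym (remove Z i x hi))
      where
      remove : ∀ A v b → lookup A v ≡ b → ∣ A ∣ ≡ (if b then suc else id) ∣ delete A v ∣
      remove A v true  h = ∣delete∣ A v h
      remove A v false h = ∣delete∣-∉ A v h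

    card-onesAt : ∀ x y s t → lookup Z i ≡ x → lookup Z j ≡ y → ∣ Z ∣ ≡ s → ∣ ∁ Z ∣ ≡ t →
                  Card (OnesAt Z) (countS x y s t)
    card-onesAt true true zero t hi hj es et with () ← size hi hj es
    card-onesAt true true (suc zero) t hi hj es et with () ← size hi hj es
    card-onesAt true true (suc (suc zero)) t hi hj es et =
      no-ordinary (ℕ.suc-injective (ℕ.suc-injective (size hi hj es)))
    card-onesAt true true (suc (suc (suc s))) t hi hj es et =
      with-ordinary (ℕ.suc-injective (ℕ.suc-injective (size hi hj es))) λ r r∈ r≢i r≢j →
        card-cong (cong (C (2 + s)) et) (card-start-C r Z r∈ (const 1) (2 + s)
          (λ { u v (inj₁ (_ , refl)) f → contradiction (trans (sym (start-∈ r Z hj (r≢j ∘ sym))) f) λ ()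
             ; u v (inj₂ (_ , refl)) f → contradiction (trans (sym (start-∈ r Z hi (r≢i ∘ sym))) f) λ () }) es)
    card-onesAt true false zero t hi hj es et with () ← size hi hj es
    card-onesAt true false (suc zero) t hi hj es et = no-ordinary (ℕ.suc-injective (size hi hj es))
    card-onesAt true false (suc (suc s)) zero hi hj es et = contradiction (∈∁ Z hj) (∣∣≡0⇒∉ {A = ∁ Z} et)
    card-onesAt true false (suc (suc s)) (suc t) hi hj es et =
      with-ordinary (ℕ.suc-injective (size hi hj es)) λ r r∈ r≢i r≢j →
        card-start-X r Z r∈ (const 1) i j s t (inj₁ (refl , refl)) (r≢i ∘ sym) hi hj es et
    card-onesAt false true zero t hi hj es et with () ← size hi hj es
    card-onesAt false true (suc zero) t hi hj es et = no-ordinary (ℕ.suc-injective (size hi hj es))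
    card-onesAt false true (suc (suc s)) zero hi hj es et = contradiction (∈∁ Z hi) (∣∣≡0⇒∉ {A = ∁ Z} et)
    card-onesAt false true (suc (suc s)) (suc t) hi hj es et =
      with-ordinary (ℕ.suc-injective (size hi hj es)) λ r r∈ r≢i r≢j →
        card-start-X r Z r∈ (const 1) j i s t (inj₂ (refl , refl)) (r≢j ∘ sym) hj hi es et
    card-onesAt false false zero t hi hj es et = no-ordinary (size hi hj es)
    card-onesAt false false (suc s) zero hi hj es et = contradiction (∈∁ Z hj) (∣∣≡0⇒∉ {A = ∁ Z} et)
    card-onesAt false false (suc s) (suc zero) hi hj es et =
      contradiction (∣∣≡1⇒unique {A = ∁ Z} et (∈∁ Z hi) (∈∁ Z hj)) i≢j
    card-onesAt false false (suc s) (suc (suc t)) hi hj es et =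
      with-ordinary (size hi hj es) λ r r∈ _ _ → card-start-D r Z r∈ (const 1) s t hi hj es et

  card-spherical : ∀ {m} → n ≡ 2 + m → Card Spherical (bin m total)
  card-spherical {m} refl = card-cong (bin-cong m λ s t _ → bin₂-countS s t)
    (card-⇔ (λ (_ , spherical , _) → spherical) (λ {w} → to w)
      (card-fibres i j i≢j countS (λ {S} {T} {w} → onesAt-unique S T w) λ Z → card-onesAt Z _ _ _ _ refl refl refl refl))
    where
    to : ∀ w → Spherical w → ∃ λ Z → OnesAt Z w
    to w spherical = select (λ v → lookup w v ℕ.≟ 1) , spherical ,
      select⇒ (λ v → lookup w v ℕ.≟ 1) , select⇐ (λ v → lookup w v ℕ.≟ 1)

-- Membership in monomial ideals

module _ {n : ℕ} where

  Divides : Vec ℕ n → Vec ℕ n → Set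
  Divides u v = ∀ i → lookup u i ≤ lookup v i

  divides-multiple : ∀ u e → Divides e (zipWith _+_ u e)
  divides-multiple u e i = ℕ.≤-trans (ℕ.m≤n+m _ (lookup u i)) (ℕ.≤-reflexive (sym (lookup-zipWith _+_ i u e)))

module _ {c ℓ₁ ℓ₂ s : Level} (𝕂 : HeytingField c ℓ₁ ℓ₂) (n : ℕ) where
  open Polynomial 𝕂 n
  private
    module 𝕂 = HeytingField 𝕂
    ring = record { isCommutativeRing = 𝕂.isCommutativeRing }
    module R = CommutativeRing ring

  -- Elements with invertible difference are apart, and 1 is inverse to 1 - 0.
  1≉0 : ¬ 𝕂.1# 𝕂.≈ 𝕂.0#
  1≉0 1≈0 = 𝕂.#-irrefl 1≈0 (𝕂.invertible⇒# (𝕂.1# , inverseˡ , inverseʳ))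
    where
    open Group R.+-group using (ε⁻¹≈ε)
    1-0≈1 : 𝕂.1# 𝕂.+ (𝕂.- 𝕂.0#) 𝕂.≈ 𝕂.1#
    1-0≈1 = 𝕂.trans (𝕂.+-cong 𝕂.refl ε⁻¹≈ε) (𝕂.+-identityʳ _)
    inverseˡ = 𝕂.trans (𝕂.*-identityˡ _) 1-0≈1
    inverseʳ = 𝕂.trans (𝕂.*-identityʳ _) 1-0≈1

  coeff-*ₚ-monomial : ∀ q r {e v} → ¬ Divides e v → coeff (q *ₚ x^ e +ₚ r) v ≡ coeff r v
  coeff-*ₚ-monomial []            r         ¬e∣v = refl
  coeff-*ₚ-monomial ((a , u) ∷ q) r {e} {v} ¬e∣v rewrite dec-false (≡-dec ℕ._≟_ (zipWith _+_ u e) v) (λ { refl → ¬e∣v (divides-multiple u e) }) =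
    coeff-*ₚ-monomial q r ¬e∣v

  -- A combination of monomials that do not divide the monomial of exponent v has coefficient 0 at
  -- v, while that monomial has coefficient 1 there.
  indivisible⇒∉⟨⟩ : ∀ {S : Pred Poly s} v → (∀ {g} → S g → ∃ λ e → g ≡ x^ e × ¬ Divides e v) → ¬ (x^ v) ∈⟨ S ⟩
  indivisible⇒∉⟨⟩ {S} v monomials (ts , eq) = 1≉0 (𝕂.trans (𝕂.sym coeff-1) (𝕂.trans (eq v) (𝕂.reflexive (coeff-0 ts))))
    where
    coeff-1 : coeff (x^ v) v 𝕂.≈ 𝕂.1#
    coeff-1 rewrite dec-true (≡-dec ℕ._≟_ v v) refl = 𝕂.+-identityʳ 𝕂.1#
    coeff-0 : ∀ ts → coeff (foldr (λ (q , g , _) r → q *ₚ g +ₚ r) 0ₚ ts) v ≡ 𝕂.0#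
    coeff-0 []                 = refl
    coeff-0 ((q , g , Sg) ∷ ts) with monomials Sg
    ... | e , refl , ¬e∣v = trans (coeff-*ₚ-monomial q _ ¬e∣v) (coeff-0 ts)

  divides⇒∈⟨⟩ : ∀ {S : Pred Poly s} e v → S (x^ e) → Divides e v → (x^ v) ∈⟨ S ⟩
  divides⇒∈⟨⟩ {S} e v Se e∣v = (x^ u , x^ e , Se) ∷ [] , eq
    where
    u : Vec ℕ n
    u = zipWith _∸_ v e
    u+e≡v : zipWith _+_ u e ≡ v
    u+e≡v = vec-ext λ i → trans (lookup-zipWith _+_ i u e)
      (trans (cong (_+ lookup e i) (lookup-zipWith _∸_ i v e)) (ℕ.m∸n+n≡m (e∣v i)))
    eq : ∀ w → coeff (x^ v) w 𝕂.≈ coeff ((x^ u) *ₚ (x^ e) +ₚ 0ₚ) w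
    eq w rewrite u+e≡v with does (≡-dec ℕ._≟_ v w)
    ... | true  = 𝕂.+-cong (𝕂.sym (𝕂.*-identityˡ 𝕂.1#)) 𝕂.refl
    ... | false = 𝕂.refl

-- Spherical parking functions of the complete graph without the edge i j

module _ {m : ℕ} (i j : Fin (2 + m)) (i≢j : i ≢ j) where
  private
    n = 2 + m
    G = deleteEdge (complete (suc n)) (suc i) (suc j)
  open Multigraph G using (edges)

  E : Fin n → Fin n → ℕ
  E u v = edges (suc u) (suc v)

  E-blocked : ∀ {u v} → Blocked i j u v → E u v ≡ 0
  E-blocked (inj₁ (refl , refl)) rewrite dec-true (i Fin.≟ i) refl | dec-true (j Fin.≟ j) refl | dec-false (i Fin.≟ j) i≢j = refl
  E-blocked (inj₂ (refl , refl)) rewrite dec-true (i Fin.≟ i) refl | dec-true (j Fin.≟ j) refl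
    | Bool.∨-zeroʳ (does (j Fin.≟ i) ∧ does (i Fin.≟ j)) | dec-false (j Fin.≟ i) (i≢j ∘ sym) = refl

  E-adjacent : ∀ {u v} → u ≢ v → ¬ Blocked i j u v → E u v ≡ 1
  E-adjacent {u} {v} u≢v ¬b with u Fin.≟ i | v Fin.≟ j | v Fin.≟ i | u Fin.≟ j
  ... | yes a | yes b | _     | _     = contradiction (inj₁ (a , b)) ¬b
  ... | yes a | no _  | yes b | yes c = contradiction (trans a (sym b)) u≢v
  ... | no _  | _     | yes b | yes c = contradiction (inj₂ (c , b)) ¬b
  ... | yes _ | no _  | yes _ | no _  rewrite dec-false (u Fin.≟ v) u≢v = refl
  ... | yes _ | no _  | no _  | _     rewrite dec-false (u Fin.≟ v) u≢v = refl
  ... | no _  | yes _ | yes _ | no _  rewrite dec-false (u Fin.≟ v) u≢v = refl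
  ... | no _  | yes _ | no _  | _     rewrite dec-false (u Fin.≟ v) u≢v = refl
  ... | no _  | no _  | yes _ | no _  rewrite dec-false (u Fin.≟ v) u≢v = refl
  ... | no _  | no _  | no _  | _     rewrite dec-false (u Fin.≟ v) u≢v = refl

  d≡degree : ∀ A a → d G A a ≡ degree i≢j E E-blocked E-adjacent (∁ A) a
  -- The split lets the multiplicity at the root 0 compute to 1, as the deleted edge does not touch
  -- the root; this term is the `suc` in `degree`.
  d≡degree A a with does (a Fin.≟ i) | does (a Fin.≟ j)
  ... | true  | true  = refl
  ... | true  | false = refl
  ... | false | true  = refl
  ... | false | false = refl

  Good : Vec ℕ n → Set
  Good = Spherical i≢j E E-blocked E-adjacent

  degree⊤ : ∀ a → d G ⊤ a ≡ 1
  degree⊤ a = trans (d≡degree ⊤ a) (degree-empty i≢j E E-blocked E-adjacent (∁ ⊤) a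
    λ v → trans (lookup-∁ ⊤ v) (cong not (lookup-replicate v true)))

  d-positive : ∀ A a → 1 ≤ d G A a
  d-positive A a = subst (1 ≤_) (sym (d≡degree A a)) (s≤s z≤n)

  module _ (A : Subset n) (p : Vec ℕ n) where

    private
      exponent : Fin n → ℕ
      exponent a = if lookup A a then d G A a else 0

    mExponent-∈ : ∀ a → lookup A a ≡ true → lookup (mExponent G A) a ≡ d G A a
    mExponent-∈ a a∈ = trans (lookup∘tabulate exponent a) (cong (λ b → if b then d G A a else 0) a∈)

    below⇒¬divides : (∃ λ a → lookup A a ≡ true × lookup p a < d G A a) → ¬ Divides (mExponent G A) p
    below⇒¬divides (a , a∈ , lt) divides = ℕ.<⇒≱ lt (subst (_≤ lookup p a) (mExponent-∈ a a∈) (divides a))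

    ¬divides⇒below : ¬ Divides (mExponent G A) p → ∃ λ a → lookup A a ≡ true × lookup p a < d G A a
    ¬divides⇒below ¬divides with a , ¬le ← Fin.¬∀⟶∃¬ n _ (λ a → lookup (mExponent G A) a ℕ.≤? lookup p a) ¬divides =
      a , cases (lookup A a) refl
      where
      cases : ∀ b → lookup A a ≡ b → lookup A a ≡ true × lookup p a < d G A a
      cases true  h = h , subst (lookup p a <_) (mExponent-∈ a h) (ℕ.≰⇒> ¬le)
      cases false h = contradiction
        (subst (_≤ lookup p a) (sym (trans (lookup∘tabulate exponent a) (cong (λ b → if b then d G A a else 0) h))) z≤n) ¬le

  -- As n = 2 + m, the bound is n - 1: with the converse below, the smaller ideal is generated by
  -- the monomials of the proper nonempty sets.
  small⇒proper : ∀ A → ∣ A ∣ ≤ m + 1 → ∃ λ b → lookup A b ≡ false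
  small⇒proper A le with ∣ ∁ A ∣ in e
  ... | zero  = contradiction (ℕ.≤-trans (ℕ.≤-reflexive (trans (sym (∣∁∣ A)) (trans (cong (∣ A ∣ +_) e) (ℕ.+-identityʳ _)))) le)
                                (ℕ.<⇒≱ (ℕ.≤-reflexive (cong suc (ℕ.+-comm m 1))))
  ... | suc _ = let (b , h) = ∣∣≡suc⇒nonempty (∁ A) e in
      b , trans (sym (Bool.not-involutive _)) (cong not (trans (sym (lookup-∁ A b)) h))

  proper⇒small : ∀ A → (∃ λ b → lookup A b ≡ false) → ∣ A ∣ ≤ m + 1
  proper⇒small A (b , h) = ℕ.≤-pred (ℕ.≤-trans
      (ℕ.≤-trans (ℕ.≤-reflexive (ℕ.+-comm 1 ∣ A ∣))
        (ℕ.+-monoʳ-≤ ∣ A ∣ (subst (1 ≤_) (sym (∣delete∣ (∁ A) b (∈∁ A h))) (s≤s z≤n))))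
      (ℕ.≤-reflexive (trans (∣∁∣ A) (cong suc (ℕ.+-comm 1 m)))))

  module _ {c ℓ₁ ℓ₂} (𝕂 : HeytingField c ℓ₁ ℓ₂) where

    isSphericalPF⇒ : ∀ p → IsSphericalPF G 𝕂 p → Good p
    isSphericalPF⇒ p (member , ¬small) = positive , λ A (a , a∈) proper →
      let (a′ , a′∈ , lt) = ¬divides⇒below A p (¬divides-proper A (a , a∈) proper)
      in a′ , a′∈ , subst (lookup p a′ <_) (d≡degree A a′) lt
      where
      ¬divides-proper : ∀ A → (∃ λ a → lookup A a ≡ true) → (∃ λ b → lookup A b ≡ false) → ¬ Divides (mExponent G A) p
      ¬divides-proper A (a , a∈) proper divides = ¬small
        (divides⇒∈⟨⟩ 𝕂 n (mExponent G A) p (A , (a , lookup⇒[]= a A a∈) , proper⇒small A proper , refl) divides)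
      positive : ∀ v → 1 ≤ lookup p v
      positive v with 1 ℕ.≤? lookup p v
      ... | yes le = le
      ... | no ¬le = contradiction member (indivisible⇒∉⟨⟩ 𝕂 n p λ { (A , (a , a∈) , refl) →
        mExponent G A , refl , ¬divides A (a , []=⇒lookup a∈) (lookup A v) refl })
        where
        -- If p vanished at v, no generator could divide: a set missing v is proper, and one
        -- containing v has a positive exponent there.
        ¬divides : ∀ A → (∃ λ a → lookup A a ≡ true) → ∀ b → lookup A v ≡ b → ¬ Divides (mExponent G A) p
        ¬divides A nonempty false h = ¬divides-proper A nonempty (v , h)
        ¬divides A nonempty true  h = below⇒¬divides A p (v , h , ℕ.<-≤-trans (ℕ.≰⇒> ¬le) (d-positive A v))

    isSphericalPF⇐ : ∀ p → Good p → IsSphericalPF G 𝕂 p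
    isSphericalPF⇐ p (positive , condition) =
      -- The generator of the full set is the product of all variables, and it divides because p is
      -- positive.
      divides⇒∈⟨⟩ 𝕂 n (mExponent G ⊤) p (⊤ , (i , lookup⇒[]= i ⊤ (lookup-replicate i true)) , refl) divides ,
      indivisible⇒∉⟨⟩ 𝕂 n p λ { (A , (a , a∈) , le , refl) → mExponent G A , refl , below⇒¬divides A p
        (let (a′ , a′∈ , lt) = condition A (a , []=⇒lookup a∈) (small⇒proper A le)
         in a′ , a′∈ , subst (lookup p a′ <_) (sym (d≡degree A a′)) lt) }
      where
      divides : Divides (mExponent G ⊤) p
      divides a = subst (_≤ lookup p a)
        (sym (trans (mExponent-∈ ⊤ p a (lookup-replicate a true)) (degree⊤ a))) (positive a)

    card-sPF : HasCardinality (sPF 𝕂 G) (bin m total)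
    card-sPF = card-⇔ (λ {p} → isSphericalPF⇐ p) (λ {p} → isSphericalPF⇒ p)
      (card-spherical i≢j E E-blocked E-adjacent refl)

theorem3p10 : ∀ {c ℓ₁ ℓ₂} (𝕂 : HeytingField c ℓ₁ ℓ₂) (n : ℕ) → 3 ≤ n → (i j : Fin n) → i ≢ j →
    HasCardinality (sPF 𝕂 (deleteEdge (complete (suc n)) (suc i) (suc j))) ((n ∸ 1) ^ (n ∸ 3) * (n ∸ 2) ^ 2)
    × HasCardinality (𝒰′ n) ((n ∸ 1) ^ (n ∸ 3) * (n ∸ 2) ^ 2)
theorem3p10 𝕂 (suc (suc (suc m))) (s≤s (s≤s (s≤s z≤n))) i j i≢j =
  subst (HasCardinality _) (bin-total m) (card-sPF i j i≢j 𝕂) ,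
  subst (HasCardinality _) (bin-total m) (card-𝒰′ (suc m))
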